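{- Let $R$ be one of the chain rings $\mathbb{G}_4=\mathbb{Z}_4[X]/(X^2+X+1)$, $\mathbb{S}_4=\mathbb{F}_4[X]/(X^2)$, $\mathbb{T}_4=\mathbb{F}_4[X;a\mapsto a^2]/(X^2)$. Then there exists a projective $(201,13)$-arc in $\mathrm{PHG}(2,R)$.
   Context: $\mathbb{F}_4[X;a\mapsto a^2]$ denotes the skew polynomial ring with commutation rule $Xa=a^2X$. For a finite chain ring $R$ of length $2$ with residue field $\mathbb{F}_q$, the projective Hjelmslev plane $\mathrm{PHG}(2,R)$ is the incidence structure whose points are the free rank-$1$ submodules of the right module $R_R^3$, whose lines are the free rank-$2$ submodules of $R_R^3$, with incidence given by inclusion. A projective $(k,n)$-arc is a set of $k$ points meeting every line in at most $n$ points. -}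

module Defs where

open import Level using (Level; _⊔_; 0ℓ) renaming (suc to lsuc)
open import Algebra.Bundles using (Ring; CommutativeRing; CommutativeMonoid)
open import Algebra.Bundles.Raw using (RawRing)
open import Algebra.Definitions.RawMonoid using (sum)
open import Algebra.Module.Bundles using (RightModule)
open import Algebra.Structures using (IsRing)
open import Algebra.Morphism.Structures using (IsRingHomomorphism)
open import Algebra.Morphism.Construct.Identity using (isRingHomomorphism)
import Algebra.Properties.CommutativeSemigroup as CommutativeSemigroupProperties
import Algebra.Properties.Ring as RingProperties
open import Data.Fin.Base using (Fin)
open import Data.Fin.Subset using (Subset; ∣_∣) renaming (_∈_ to _∈ₛ_)
open import Data.Integer.Base using (+_)
open import Data.Integer.Properties using (+-*-commutativeRing)
open import Data.List.Base using (List; []; _∷_; map)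
open import Data.Nat.Base using (ℕ; zero; suc) renaming (_≤_ to _≤ℕ_)
open import Data.Product.Base using (_,_; ∃-syntax)
open import Function.Base using (id)
open import Function.Definitions using (Injective)
open import Relation.Binary.Bundles using (Setoid)
open import Relation.Binary.PropositionalEquality.Core using (_≡_)
import Relation.Binary.Reasoning.Setoid as SetoidReasoning
open import Relation.Unary using (Pred; _∈_; _⊆_; _≐_)

private
  variable
    c ℓ m ℓm : Level

-- A list a₀ ∷ a₁ ∷ … ∷ aₙ ∷ [] stands for a₀ + a₁X + … + aₙXⁿ (coefficients
-- on the left of the powers of X, trailing zeros allowed), and Xa = σ(a)X.
-- The operations are defined over a raw ring so that no proof of a ring law
-- occurs in them, which keeps conversion checking on iterated constructions cheap.

module SkewPolynomial (A : RawRing c ℓ) (σ : RawRing.Carrier A → RawRing.Carrier A) where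

  open RawRing A

  Poly : Set c
  Poly = List Carrier

  coeff : Poly → ℕ → Carrier
  coeff []      n       = 0#
  coeff (a ∷ p) zero    = a
  coeff (a ∷ p) (suc n) = coeff p n

  infix 4 _≋_
  record _≋_ (p q : Poly) : Set ℓ where
    constructor mk≋
    field
      at : ∀ n → coeff p n ≈ coeff q n
  open _≋_ public

  infixl 6 _⊕_
  infixl 7 _⊗_ _·_

  _⊕_ : Poly → Poly → Poly
  []      ⊕ q       = q
  (a ∷ p) ⊕ []      = a ∷ p
  (a ∷ p) ⊕ (b ∷ q) = (a + b) ∷ (p ⊕ q)

  ⊖_ : Poly → Poly
  ⊖_ = map (-_)

  _·_ : Carrier → Poly → Poly
  a · p = map (a *_) p

  -- Left multiplication by X:  X · Σ bᵢXⁱ = Σ σ(bᵢ)Xⁱ⁺¹.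
  X· : Poly → Poly
  X· p = 0# ∷ map σ p

  -- (a + p·X) · q = a·q + p·(X·q).
  _⊗_ : Poly → Poly → Poly
  []      ⊗ q = []
  (a ∷ p) ⊗ q = a · q ⊕ p ⊗ X· q

  one : Poly
  one = 1# ∷ []

  rawRing : RawRing c ℓ
  rawRing = record
    { Carrier = Poly
    ; _≈_     = _≋_
    ; _+_     = _⊕_
    ; _*_     = _⊗_
    ; -_      = ⊖_
    ; 0#      = []
    ; 1#      = one
    }

module SkewPolynomialProperties
  (A : Ring c ℓ)
  (σ : Ring.Carrier A → Ring.Carrier A)
  (σ-hom : IsRingHomomorphism (Ring.rawRing A) (Ring.rawRing A) σ)
  where

  open Ring A
  open SkewPolynomial (Ring.rawRing A) σ hiding (rawRing)
  open IsRingHomomorphism σ-hom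
    using (⟦⟧-cong; +-homo; *-homo; 0#-homo; 1#-homo)
  open RingProperties A using (-0#≈0#)
  open CommutativeSemigroupProperties
    (CommutativeMonoid.commutativeSemigroup +-commutativeMonoid)
    using (interchange)

  private
    ≋-refl : ∀ {p} → p ≋ p
    ≋-refl .at n = refl

    ≋-sym : ∀ {p q} → p ≋ q → q ≋ p
    ≋-sym e .at n = sym (at e n)

    ≋-trans : ∀ {p q r} → p ≋ q → q ≋ r → p ≋ r
    ≋-trans e f .at n = trans (at e n) (at f n)

    ≋-setoid : Setoid c ℓ
    ≋-setoid = record
      { Carrier = Poly
      ; _≈_ = _≋_
      ; isEquivalence = record
        { refl = ≋-refl ; sym = ≋-sym ; trans = ≋-trans } }

    infixr 5 _∷≋_
    _∷≋_ : ∀ {a b p q} → a ≈ b → p ≋ q → a ∷ p ≋ b ∷ q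
    (e ∷≋ f) .at zero    = e
    (e ∷≋ f) .at (suc n) = at f n

    tail≋ : ∀ {a b p q} → a ∷ p ≋ b ∷ q → p ≋ q
    tail≋ e .at n = at e (suc n)

    0∷[] : 0# ∷ [] ≋ []
    0∷[] .at zero    = refl
    0∷[] .at (suc n) = refl

    coeff-⊕ : ∀ p q n → coeff (p ⊕ q) n ≈ coeff p n + coeff q n
    coeff-⊕ []      q       n       = sym (+-identityˡ _)
    coeff-⊕ (a ∷ p) []      n       = sym (+-identityʳ _)
    coeff-⊕ (a ∷ p) (b ∷ q) zero    = refl
    coeff-⊕ (a ∷ p) (b ∷ q) (suc n) = coeff-⊕ p q n

    coeff-map : ∀ (g : Carrier → Carrier) → g 0# ≈ 0# →
                ∀ p n → coeff (map g p) n ≈ g (coeff p n)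
    coeff-map g g0 []      n       = sym g0
    coeff-map g g0 (a ∷ p) zero    = refl
    coeff-map g g0 (a ∷ p) (suc n) = coeff-map g g0 p n

    coeff-⊖ : ∀ p n → coeff (⊖ p) n ≈ - coeff p n
    coeff-⊖ = coeff-map (-_) -0#≈0#

    coeff-· : ∀ a p n → coeff (a · p) n ≈ a * coeff p n
    coeff-· a = coeff-map (a *_) (zeroʳ a)

    coeff-σ : ∀ p n → coeff (map σ p) n ≈ σ (coeff p n)
    coeff-σ = coeff-map σ 0#-homo

    ⊕-cong : ∀ {p p′ q q′} → p ≋ p′ → q ≋ q′ → p ⊕ q ≋ p′ ⊕ q′
    ⊕-cong {p} {p′} {q} {q′} e f .at n = trans (coeff-⊕ p q n)
      (trans (+-cong (at e n) (at f n)) (sym (coeff-⊕ p′ q′ n)))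

    ⊕-assoc : ∀ p q r → (p ⊕ q) ⊕ r ≋ p ⊕ (q ⊕ r)
    ⊕-assoc p q r .at n = begin
      coeff ((p ⊕ q) ⊕ r) n              ≈⟨ coeff-⊕ (p ⊕ q) r n ⟩
      coeff (p ⊕ q) n + coeff r n        ≈⟨ +-congʳ (coeff-⊕ p q n) ⟩
      coeff p n + coeff q n + coeff r n  ≈⟨ +-assoc _ _ _ ⟩
      coeff p n + (coeff q n + coeff r n) ≈⟨ +-congˡ (coeff-⊕ q r n) ⟨
      coeff p n + coeff (q ⊕ r) n        ≈⟨ coeff-⊕ p (q ⊕ r) n ⟨
      coeff (p ⊕ (q ⊕ r)) n              ∎
      where open SetoidReasoning setoid

    ⊕-comm : ∀ p q → p ⊕ q ≋ q ⊕ p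
    ⊕-comm p q .at n = trans (coeff-⊕ p q n)
      (trans (+-comm _ _) (sym (coeff-⊕ q p n)))

    ⊕-identityˡ : ∀ p → [] ⊕ p ≋ p
    ⊕-identityˡ p = ≋-refl

    ⊕-identityʳ : ∀ p → p ⊕ [] ≋ p
    ⊕-identityʳ p = ⊕-comm p []

    ⊖-cong : ∀ {p q} → p ≋ q → ⊖ p ≋ ⊖ q
    ⊖-cong {p} {q} e .at n =
      trans (coeff-⊖ p n) (trans (-‿cong (at e n)) (sym (coeff-⊖ q n)))

    ⊖-inverseˡ : ∀ p → (⊖ p) ⊕ p ≋ []
    ⊖-inverseˡ p .at n = trans (coeff-⊕ (⊖ p) p n)
      (trans (+-congʳ (coeff-⊖ p n)) (-‿inverseˡ _))

    ⊖-inverseʳ : ∀ p → p ⊕ (⊖ p) ≋ []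
    ⊖-inverseʳ p = ≋-trans (⊕-comm p (⊖ p)) (⊖-inverseˡ p)

    ⊕-interchange : ∀ p q r s → (p ⊕ q) ⊕ (r ⊕ s) ≋ (p ⊕ r) ⊕ (q ⊕ s)
    ⊕-interchange p q r s .at n = begin
      coeff ((p ⊕ q) ⊕ (r ⊕ s)) n
        ≈⟨ expand p q r s ⟩
      (coeff p n + coeff q n) + (coeff r n + coeff s n)
        ≈⟨ interchange _ _ _ _ ⟩
      (coeff p n + coeff r n) + (coeff q n + coeff s n)
        ≈⟨ expand p r q s ⟨
      coeff ((p ⊕ r) ⊕ (q ⊕ s)) n ∎
      where
      open SetoidReasoning setoid
      expand : ∀ p q r s → coeff ((p ⊕ q) ⊕ (r ⊕ s)) n ≈
               (coeff p n + coeff q n) + (coeff r n + coeff s n)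
      expand p q r s = trans (coeff-⊕ (p ⊕ q) (r ⊕ s) n)
                             (+-cong (coeff-⊕ p q n) (coeff-⊕ r s n))

    ·-cong : ∀ {a b p q} → a ≈ b → p ≋ q → a · p ≋ b · q
    ·-cong {a} {b} {p} {q} e f .at n = trans (coeff-· a p n)
      (trans (*-cong e (at f n)) (sym (coeff-· b q n)))

    ·-distribˡ : ∀ a p q → a · (p ⊕ q) ≋ a · p ⊕ a · q
    ·-distribˡ a p q .at n = begin
      coeff (a · (p ⊕ q)) n                ≈⟨ coeff-· a (p ⊕ q) n ⟩
      a * coeff (p ⊕ q) n                  ≈⟨ *-congˡ (coeff-⊕ p q n) ⟩
      a * (coeff p n + coeff q n)          ≈⟨ distribˡ a _ _ ⟩
      a * coeff p n + a * coeff q n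
        ≈⟨ +-cong (coeff-· a p n) (coeff-· a q n) ⟨
      coeff (a · p) n + coeff (a · q) n    ≈⟨ coeff-⊕ (a · p) (a · q) n ⟨
      coeff (a · p ⊕ a · q) n              ∎
      where open SetoidReasoning setoid

    ·-distribʳ : ∀ a b p → (a + b) · p ≋ a · p ⊕ b · p
    ·-distribʳ a b p .at n = begin
      coeff ((a + b) · p) n                ≈⟨ coeff-· (a + b) p n ⟩
      (a + b) * coeff p n                  ≈⟨ distribʳ _ a b ⟩
      a * coeff p n + b * coeff p n
        ≈⟨ +-cong (coeff-· a p n) (coeff-· b p n) ⟨
      coeff (a · p) n + coeff (b · p) n    ≈⟨ coeff-⊕ (a · p) (b · p) n ⟨
      coeff (a · p ⊕ b · p) n              ∎
      where open SetoidReasoning setoid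

    ·-assoc : ∀ a b p → (a * b) · p ≋ a · (b · p)
    ·-assoc a b p .at n = begin
      coeff ((a * b) · p) n    ≈⟨ coeff-· (a * b) p n ⟩
      (a * b) * coeff p n      ≈⟨ *-assoc a b _ ⟩
      a * (b * coeff p n)      ≈⟨ *-congˡ (coeff-· b p n) ⟨
      a * coeff (b · p) n      ≈⟨ coeff-· a (b · p) n ⟨
      coeff (a · (b · p)) n    ∎
      where open SetoidReasoning setoid

    0· : ∀ p → 0# · p ≋ []
    0· p .at n = trans (coeff-· 0# p n) (zeroˡ _)

    1· : ∀ p → 1# · p ≋ p
    1· p .at n = trans (coeff-· 1# p n) (*-identityˡ _)

    map-σ-cong : ∀ {p q} → p ≋ q → map σ p ≋ map σ q
    map-σ-cong {p} {q} e .at n =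
      trans (coeff-σ p n) (trans (⟦⟧-cong (at e n)) (sym (coeff-σ q n)))

    X·-cong : ∀ {p q} → p ≋ q → X· p ≋ X· q
    X·-cong e = refl ∷≋ map-σ-cong e

    X·-⊕ : ∀ p q → X· (p ⊕ q) ≋ X· p ⊕ X· q
    X·-⊕ p q = sym (+-identityˡ 0#) ∷≋ mk≋ λ n → begin
      coeff (map σ (p ⊕ q)) n                    ≈⟨ coeff-σ (p ⊕ q) n ⟩
      σ (coeff (p ⊕ q) n)                        ≈⟨ ⟦⟧-cong (coeff-⊕ p q n) ⟩
      σ (coeff p n + coeff q n)                  ≈⟨ +-homo _ _ ⟩
      σ (coeff p n) + σ (coeff q n)
        ≈⟨ +-cong (coeff-σ p n) (coeff-σ q n) ⟨
      coeff (map σ p) n + coeff (map σ q) n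
        ≈⟨ coeff-⊕ (map σ p) (map σ q) n ⟨
      coeff (map σ p ⊕ map σ q) n                ∎
      where open SetoidReasoning setoid

    X·-· : ∀ a p → X· (a · p) ≋ σ a · X· p
    X·-· a p = sym (zeroʳ (σ a)) ∷≋ mk≋ λ n → begin
      coeff (map σ (a · p)) n      ≈⟨ coeff-σ (a · p) n ⟩
      σ (coeff (a · p) n)          ≈⟨ ⟦⟧-cong (coeff-· a p n) ⟩
      σ (a * coeff p n)            ≈⟨ *-homo _ _ ⟩
      σ a * σ (coeff p n)          ≈⟨ *-congˡ (coeff-σ p n) ⟨
      σ a * coeff (map σ p) n      ≈⟨ coeff-· (σ a) (map σ p) n ⟨
      coeff (σ a · map σ p) n      ∎
      where open SetoidReasoning setoid

    ⊗-congˡ : ∀ p {q q′} → q ≋ q′ → p ⊗ q ≋ p ⊗ q′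
    ⊗-congˡ []      e = ≋-refl
    ⊗-congˡ (a ∷ p) e = ⊕-cong (·-cong refl e) (⊗-congˡ p (X·-cong e))

    ⊗-zeroˡ′ : ∀ p q → p ≋ [] → p ⊗ q ≋ []
    ⊗-zeroˡ′ []      q e = ≋-refl
    ⊗-zeroˡ′ (a ∷ p) q e =
      ⊕-cong (≋-trans (·-cong {p = q} (at e 0) ≋-refl) (0· q))
             (⊗-zeroˡ′ p (X· q) (mk≋ λ n → at e (suc n)))

    ⊗-congʳ : ∀ p p′ q → p ≋ p′ → p ⊗ q ≋ p′ ⊗ q
    ⊗-congʳ []      p′       q e = ≋-sym (⊗-zeroˡ′ p′ q (≋-sym e))
    ⊗-congʳ (a ∷ p) []       q e = ⊗-zeroˡ′ (a ∷ p) q e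
    ⊗-congʳ (a ∷ p) (b ∷ p′) q e =
      ⊕-cong (·-cong {p = q} (at e 0) ≋-refl) (⊗-congʳ p p′ (X· q) (tail≋ e))

    ⊗-cong : ∀ {p p′ q q′} → p ≋ p′ → q ≋ q′ → p ⊗ q ≋ p′ ⊗ q′
    ⊗-cong {p} {p′} {q} e f = ≋-trans (⊗-congʳ p p′ q e) (⊗-congˡ p′ f)

    ⊗-distribˡ : ∀ p q r → p ⊗ (q ⊕ r) ≋ p ⊗ q ⊕ p ⊗ r
    ⊗-distribˡ []      q r = ≋-refl
    ⊗-distribˡ (a ∷ p) q r = begin
      a · (q ⊕ r) ⊕ p ⊗ X· (q ⊕ r)
        ≈⟨ ⊕-cong (·-distribˡ a q r)
             (≋-trans (⊗-congˡ p (X·-⊕ q r)) (⊗-distribˡ p (X· q) (X· r))) ⟩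
      (a · q ⊕ a · r) ⊕ (p ⊗ X· q ⊕ p ⊗ X· r)
        ≈⟨ ⊕-interchange (a · q) (a · r) _ _ ⟩
      (a · q ⊕ p ⊗ X· q) ⊕ (a · r ⊕ p ⊗ X· r) ∎
      where open SetoidReasoning ≋-setoid

    ⊗-distribʳ : ∀ r p q → (p ⊕ q) ⊗ r ≋ p ⊗ r ⊕ q ⊗ r
    ⊗-distribʳ r []      q       = ≋-refl
    ⊗-distribʳ r (a ∷ p) []      = ≋-sym (⊕-identityʳ _)
    ⊗-distribʳ r (a ∷ p) (b ∷ q) = begin
      (a + b) · r ⊕ (p ⊕ q) ⊗ X· r
        ≈⟨ ⊕-cong (·-distribʳ a b r) (⊗-distribʳ (X· r) p q) ⟩
      (a · r ⊕ b · r) ⊕ (p ⊗ X· r ⊕ q ⊗ X· r)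
        ≈⟨ ⊕-interchange (a · r) (b · r) _ _ ⟩
      (a · r ⊕ p ⊗ X· r) ⊕ (b · r ⊕ q ⊗ X· r) ∎
      where open SetoidReasoning ≋-setoid

    ·-⊗ : ∀ a p q → (a · p) ⊗ q ≋ a · (p ⊗ q)
    ·-⊗ a []      q = ≋-refl
    ·-⊗ a (b ∷ p) q = begin
      (a * b) · q ⊕ (a · p) ⊗ X· q   ≈⟨ ⊕-cong (·-assoc a b q) (·-⊗ a p (X· q)) ⟩
      a · (b · q) ⊕ a · (p ⊗ X· q)   ≈⟨ ·-distribˡ a (b · q) (p ⊗ X· q) ⟨
      a · (b · q ⊕ p ⊗ X· q)         ∎
      where open SetoidReasoning ≋-setoid

    map-σ-⊗ : ∀ p q → map σ p ⊗ X· q ≋ X· (p ⊗ q)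
    map-σ-⊗ []      q = ≋-sym 0∷[]
    map-σ-⊗ (b ∷ p) q = begin
      σ b · X· q ⊕ map σ p ⊗ X· (X· q)
        ≈⟨ ⊕-cong (≋-sym (X·-· b q)) (map-σ-⊗ p (X· q)) ⟩
      X· (b · q) ⊕ X· (p ⊗ X· q)
        ≈⟨ X·-⊕ (b · q) (p ⊗ X· q) ⟨
      X· (b · q ⊕ p ⊗ X· q) ∎
      where open SetoidReasoning ≋-setoid

    X·-⊗ : ∀ p q → X· p ⊗ q ≋ X· (p ⊗ q)
    X·-⊗ p q = ≋-trans (⊕-cong (0· q) ≋-refl) (map-σ-⊗ p q)

    ⊗-assoc : ∀ p q r → (p ⊗ q) ⊗ r ≋ p ⊗ (q ⊗ r)
    ⊗-assoc []      q r = ≋-refl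
    ⊗-assoc (a ∷ p) q r = begin
      (a · q ⊕ p ⊗ X· q) ⊗ r
        ≈⟨ ⊗-distribʳ r (a · q) (p ⊗ X· q) ⟩
      (a · q) ⊗ r ⊕ (p ⊗ X· q) ⊗ r
        ≈⟨ ⊕-cong (·-⊗ a q r) (⊗-assoc p (X· q) r) ⟩
      a · (q ⊗ r) ⊕ p ⊗ (X· q ⊗ r)
        ≈⟨ ⊕-cong (≋-refl {a · (q ⊗ r)}) (⊗-congˡ p (X·-⊗ q r)) ⟩
      a · (q ⊗ r) ⊕ p ⊗ X· (q ⊗ r) ∎
      where open SetoidReasoning ≋-setoid

    ⊗-identityˡ : ∀ p → one ⊗ p ≋ p
    ⊗-identityˡ p = ≋-trans (⊕-identityʳ (1# · p)) (1· p)

  ⊗-raise : ∀ p q → p ⊗ (0# ∷ q) ≋ 0# ∷ (p ⊗ q)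
  ⊗-raise []      q = ≋-sym 0∷[]
  ⊗-raise (a ∷ p) q = begin
    a · (0# ∷ q) ⊕ p ⊗ X· (0# ∷ q)
      ≈⟨ ⊕-cong (zeroʳ a ∷≋ ≋-refl {a · q})
           (≋-trans (⊗-congˡ p (refl ∷≋ 0#-homo ∷≋ ≋-refl)) (⊗-raise p (X· q))) ⟩
    (0# + 0#) ∷ (a · q ⊕ p ⊗ X· q)
      ≈⟨ +-identityˡ 0# ∷≋ ≋-refl ⟩
    0# ∷ (a · q ⊕ p ⊗ X· q) ∎
    where open SetoidReasoning ≋-setoid

  private
    ⊗-identityʳ : ∀ p → p ⊗ one ≋ p
    ⊗-identityʳ []      = ≋-refl
    ⊗-identityʳ (a ∷ p) = begin
      a · one ⊕ p ⊗ X· one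
        ≈⟨ ⊕-cong (*-identityʳ a ∷≋ ≋-refl {[]})
             (≋-trans (⊗-congˡ p (refl ∷≋ 1#-homo ∷≋ ≋-refl))
                      (≋-trans (⊗-raise p one) (refl ∷≋ ⊗-identityʳ p))) ⟩
      (a + 0#) ∷ p
        ≈⟨ +-identityʳ a ∷≋ ≋-refl ⟩
      a ∷ p ∎
      where open SetoidReasoning ≋-setoid

  abstract
    isSkewPolynomialRing : IsRing _≋_ _⊕_ _⊗_ ⊖_ [] one
    isSkewPolynomialRing = record
      { +-isAbelianGroup = record
        { isGroup = record
          { isMonoid = record
            { isSemigroup = record
              { isMagma = record
                { isEquivalence = Setoid.isEquivalence ≋-setoid
                ; ∙-cong = ⊕-cong }
              ; assoc = ⊕-assoc }
            ; identity = ⊕-identityˡ , ⊕-identityʳ }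
          ; inverse = ⊖-inverseˡ , ⊖-inverseʳ
          ; ⁻¹-cong = ⊖-cong }
        ; comm = ⊕-comm }
      ; *-cong = ⊗-cong
      ; *-assoc = ⊗-assoc
      ; *-identity = ⊗-identityˡ , ⊗-identityʳ
      ; distrib = ⊗-distribˡ , ⊗-distribʳ }

skewPolynomialRing : (A : Ring c ℓ) (σ : Ring.Carrier A → Ring.Carrier A) →
  IsRingHomomorphism (Ring.rawRing A) (Ring.rawRing A) σ → Ring c ℓ
skewPolynomialRing A σ σ-hom =
  record { isRing = SkewPolynomialProperties.isSkewPolynomialRing A σ σ-hom }

module _ (A : CommutativeRing c ℓ) where
  private
    module A = CommutativeRing A
    id-hom = isRingHomomorphism A.rawRing A.refl
    open SkewPolynomial A.rawRing id using (_⊗_; _·_; X·; coeff; at)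
    open SkewPolynomialProperties A.ring id id-hom using (⊗-raise)
    module P = Ring (skewPolynomialRing A.ring id id-hom)
    open SetoidReasoning P.setoid

    map-id : ∀ p → X· p P.≈ A.0# ∷ p
    map-id p .at zero = A.refl
    map-id p .at (suc n) = go p n
      where
      go : ∀ p n → coeff (map id p) n A.≈ coeff p n
      go []      n       = A.refl
      go (a ∷ p) zero    = A.refl
      go (a ∷ p) (suc n) = go p n

    ∷-split : ∀ a p → a ∷ p P.≈ (a ∷ []) P.+ (A.0# ∷ p)
    ∷-split a p .at zero    = A.sym (A.+-identityʳ a)
    ∷-split a p .at (suc n) = A.refl

    ·-const : ∀ a p → p ⊗ (a ∷ []) P.≈ a · p
    ·-const a []      = P.refl
    ·-const a (b ∷ p) = begin
      ((b A.* a) ∷ []) P.+ p ⊗ X· (a ∷ [])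
        ≈⟨ P.+-congˡ (P.trans (P.*-congˡ {p} (map-id (a ∷ []))) (⊗-raise p (a ∷ []))) ⟩
      ((b A.* a) A.+ A.0#) ∷ (p ⊗ (a ∷ []))
        ≈⟨ (λ where .at zero    → A.trans (A.+-identityʳ _) (A.*-comm b a)
                    .at (suc n) → at (·-const a p) n) ⟩
      (a A.* b) ∷ (a · p) ∎

    ⊗-comm : ∀ p q → p ⊗ q P.≈ q ⊗ p
    ⊗-comm []      q = P.sym (P.zeroʳ q)
    ⊗-comm (a ∷ p) q = begin
      a · q P.+ p ⊗ X· q
        ≈⟨ P.+-cong (P.sym (·-const a q)) (P.*-congˡ {p} (map-id q)) ⟩
      q ⊗ (a ∷ []) P.+ p ⊗ (A.0# ∷ q)
        ≈⟨ P.+-congˡ {q ⊗ (a ∷ [])} (⊗-raise p q) ⟩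
      q ⊗ (a ∷ []) P.+ (A.0# ∷ (p ⊗ q))
        ≈⟨ P.+-congˡ {q ⊗ (a ∷ [])}
             (λ where .at zero → A.refl ; .at (suc n) → at (⊗-comm p q) n) ⟩
      q ⊗ (a ∷ []) P.+ (A.0# ∷ (q ⊗ p))
        ≈⟨ P.+-congˡ {q ⊗ (a ∷ [])} (⊗-raise q p) ⟨
      q ⊗ (a ∷ []) P.+ q ⊗ (A.0# ∷ p)
        ≈⟨ P.distribˡ q (a ∷ []) (A.0# ∷ p) ⟨
      q ⊗ ((a ∷ []) P.+ (A.0# ∷ p))
        ≈⟨ P.*-congˡ {q} (∷-split a p) ⟨
      q ⊗ (a ∷ p) ∎

    abstract
      *-commutative : ∀ p q → p ⊗ q P.≈ q ⊗ p
      *-commutative = ⊗-comm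

  -- A[X] = A[X;id].
  polynomialRing : CommutativeRing c ℓ
  polynomialRing = record
    { isCommutativeRing = record { isRing = P.isRing ; *-comm = *-commutative } }

module _ (R : RawRing c ℓ) where
  open RawRing R

  data TwoSidedIdeal (f : Carrier) : Pred Carrier (c ⊔ ℓ) where
    generator : f ∈ TwoSidedIdeal f
    zero-mem  : 0# ∈ TwoSidedIdeal f
    add       : ∀ {x y} → x ∈ TwoSidedIdeal f → y ∈ TwoSidedIdeal f →
                x + y ∈ TwoSidedIdeal f
    mulˡ      : ∀ r {x} → x ∈ TwoSidedIdeal f → r * x ∈ TwoSidedIdeal f
    mulʳ      : ∀ r {x} → x ∈ TwoSidedIdeal f → x * r ∈ TwoSidedIdeal f
    resp      : ∀ {x y} → x ≈ y → x ∈ TwoSidedIdeal f → y ∈ TwoSidedIdeal f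

  record CongruentMod (f x y : Carrier) : Set (c ⊔ ℓ) where
    constructor mkCong
    field
      difference : x + (- y) ∈ TwoSidedIdeal f
  open CongruentMod public

module Quotient (R : Ring c ℓ) (f : Ring.Carrier R) where
  open Ring R
  open RingProperties R
    using (-‿+-comm; -‿involutive; -1*x≈-x; -‿distribˡ-*; -‿distribʳ-*)
  open CommutativeSemigroupProperties
    (CommutativeMonoid.commutativeSemigroup +-commutativeMonoid)
    using (interchange)

  infix 4 _∼_
  _∼_ : Carrier → Carrier → Set (c ⊔ ℓ)
  _∼_ = CongruentMod rawRing f

  private
    I : Pred Carrier (c ⊔ ℓ)
    I = TwoSidedIdeal rawRing f

    open SetoidReasoning setoid

    neg : ∀ {x} → x ∈ I → - x ∈ I
    neg {x} h = resp (-1*x≈-x x) (mulˡ (- 1#) h)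

    -‿swap : ∀ x y → - (x - y) ≈ y - x
    -‿swap x y = begin
      - (x - y)      ≈⟨ -‿+-comm x (- y) ⟨
      - x + - - y    ≈⟨ +-congˡ (-‿involutive y) ⟩
      - x + y        ≈⟨ +-comm _ _ ⟩
      y - x          ∎

    telescope : ∀ x y z → (x - y) + (y - z) ≈ x - z
    telescope x y z = begin
      (x - y) + (y - z)      ≈⟨ +-assoc x (- y) (y - z) ⟩
      x + (- y + (y - z))    ≈⟨ +-congˡ (+-assoc (- y) y (- z)) ⟨
      x + ((- y + y) - z)    ≈⟨ +-congˡ (+-congʳ (-‿inverseˡ y)) ⟩
      x + (0# - z)           ≈⟨ +-congˡ (+-identityˡ _) ⟩
      x - z                  ∎

    -‿distribˡ : ∀ a x y → a * (x - y) ≈ a * x - a * y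
    -‿distribˡ a x y = trans (distribˡ a x (- y)) (+-congˡ (sym (-‿distribʳ-* a y)))

    -‿distribʳ : ∀ a x y → (x - y) * a ≈ x * a - y * a
    -‿distribʳ a x y = trans (distribʳ a x (- y)) (+-congˡ (sym (-‿distribˡ-* y a)))

  ≈⇒∼ : ∀ {x y} → x ≈ y → x ∼ y
  ≈⇒∼ {x} {y} e .difference =
    resp (sym (trans (+-congʳ e) (-‿inverseʳ y))) zero-mem

  private
    ∼-sym : ∀ {x y} → x ∼ y → y ∼ x
    ∼-sym {x} {y} h .difference = resp (-‿swap x y) (neg (difference h))

    ∼-trans : ∀ {x y z} → x ∼ y → y ∼ z → x ∼ z
    ∼-trans {x} {y} {z} h k .difference =
      resp (telescope x y z) (add (difference h) (difference k))

    ∼-+-cong : ∀ {x y u v} → x ∼ y → u ∼ v → x + u ∼ y + v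
    ∼-+-cong {x} {y} {u} {v} h k .difference =
      resp (trans (interchange x (- y) u (- v)) (+-congˡ (-‿+-comm y v)))
           (add (difference h) (difference k))

    ∼-neg-cong : ∀ {x y} → x ∼ y → - x ∼ - y
    ∼-neg-cong {x} {y} h .difference =
      resp (sym (-‿+-comm x (- y))) (neg (difference h))

    ∼-*-cong : ∀ {x y u v} → x ∼ y → u ∼ v → x * u ∼ y * v
    ∼-*-cong {x} {y} {u} {v} h k .difference =
      resp (trans (+-cong (-‿distribʳ u x y) (-‿distribˡ y u v))
                  (telescope (x * u) (y * u) (y * v)))
           (add (mulʳ u (difference h)) (mulˡ y (difference k)))

  abstract
    isQuotientRing : IsRing _∼_ _+_ _*_ -_ 0# 1#
    isQuotientRing = record
      { +-isAbelianGroup = record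
        { isGroup = record
          { isMonoid = record
            { isSemigroup = record
              { isMagma = record
                { isEquivalence = record
                  { refl = ≈⇒∼ refl ; sym = ∼-sym ; trans = ∼-trans }
                ; ∙-cong = ∼-+-cong }
              ; assoc = λ x y z → ≈⇒∼ (+-assoc x y z) }
            ; identity = (λ x → ≈⇒∼ (+-identityˡ x)) , (λ x → ≈⇒∼ (+-identityʳ x)) }
          ; inverse = (λ x → ≈⇒∼ (-‿inverseˡ x)) , (λ x → ≈⇒∼ (-‿inverseʳ x))
          ; ⁻¹-cong = ∼-neg-cong }
        ; comm = λ x y → ≈⇒∼ (+-comm x y) }
      ; *-cong = ∼-*-cong
      ; *-assoc = λ x y z → ≈⇒∼ (*-assoc x y z)
      ; *-identity = (λ x → ≈⇒∼ (*-identityˡ x)) , (λ x → ≈⇒∼ (*-identityʳ x))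
      ; distrib = (λ x y z → ≈⇒∼ (distribˡ x y z))
                , (λ x y z → ≈⇒∼ (distribʳ x y z)) }

infix 6 _/⟨_⟩ _/ᶜ⟨_⟩

_/⟨_⟩ : (R : Ring c ℓ) → Ring.Carrier R → Ring c (c ⊔ ℓ)
R /⟨ f ⟩ = record { isRing = Quotient.isQuotientRing R f }

_/ᶜ⟨_⟩ : (R : CommutativeRing c ℓ) → CommutativeRing.Carrier R →
         CommutativeRing c (c ⊔ ℓ)
R /ᶜ⟨ f ⟩ = record
  { isCommutativeRing = record
    { isRing = Ring.isRing (R.ring /⟨ f ⟩)
    ; *-comm = λ x y → Quotient.≈⇒∼ R.ring f (R.*-comm x y) } }
  where module R = CommutativeRing R

ℤ/_ : ℕ → CommutativeRing 0ℓ 0ℓ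
ℤ/ n = +-*-commutativeRing /ᶜ⟨ + n ⟩

module _ (A : Ring c ℓ) where
  open Ring A

  1+X+X² : List Carrier
  1+X+X² = 1# ∷ 1# ∷ 1# ∷ []

  X² : List Carrier
  X² = 0# ∷ 0# ∷ 1# ∷ []

𝔽₄ : CommutativeRing 0ℓ 0ℓ
𝔽₄ = polynomialRing (ℤ/ 2) /ᶜ⟨ 1+X+X² (CommutativeRing.ring (ℤ/ 2)) ⟩

square : (A : Ring c ℓ) → Ring.Carrier A → Ring.Carrier A
square A a = a * a
  where open Ring A

square-isRingHomomorphism : (A : CommutativeRing c ℓ) →
  (let open CommutativeRing A) → 1# + 1# ≈ 0# →
  IsRingHomomorphism rawRing rawRing (square ring)
square-isRingHomomorphism A 1+1≈0 = record
  { isSemiringHomomorphism = record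
    { isNearSemiringHomomorphism = record
      { +-isMonoidHomomorphism = record
        { isMagmaHomomorphism = record
          { isRelHomomorphism = record { cong = λ e → *-cong e e }
          ; homo = square-+ }
        ; ε-homo = zeroˡ 0# }
      ; *-homo = λ x y → *-interchange x y x y }
    ; 1#-homo = *-identityˡ 1# }
  ; -‿homo = λ x → begin
      - x * - x      ≈⟨ -‿distribˡ-* x (- x) ⟨
      - (x * - x)    ≈⟨ -‿cong (-‿distribʳ-* x x) ⟨
      - - (x * x)    ≈⟨ -‿cong (sym (neg≈id (x * x))) ⟨
      - (x * x)      ∎ }
  where
  open CommutativeRing A
  open RingProperties ring using (-‿distribˡ-*; -‿distribʳ-*)
  open CommutativeSemigroupProperties *-commutativeSemigroup
    using () renaming (interchange to *-interchange)
  open SetoidReasoning setoid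

  double≈0 : ∀ x → x + x ≈ 0#
  double≈0 x = begin
    x + x                ≈⟨ +-cong (*-identityˡ x) (*-identityˡ x) ⟨
    1# * x + 1# * x      ≈⟨ distribʳ x 1# 1# ⟨
    (1# + 1#) * x        ≈⟨ *-congʳ 1+1≈0 ⟩
    0# * x               ≈⟨ zeroˡ x ⟩
    0#                   ∎

  neg≈id : ∀ x → - x ≈ x
  neg≈id x = begin
    - x                ≈⟨ +-identityʳ (- x) ⟨
    - x + 0#           ≈⟨ +-congˡ (double≈0 x) ⟨
    - x + (x + x)      ≈⟨ +-assoc (- x) x x ⟨
    (- x + x) + x      ≈⟨ +-congʳ (-‿inverseˡ x) ⟩
    0# + x             ≈⟨ +-identityˡ x ⟩
    x                  ∎

  square-+ : ∀ x y → (x + y) * (x + y) ≈ x * x + y * y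
  square-+ x y = begin
    (x + y) * (x + y)                    ≈⟨ distribʳ (x + y) x y ⟩
    x * (x + y) + y * (x + y)            ≈⟨ +-cong (distribˡ x x y) (distribˡ y x y) ⟩
    (x * x + x * y) + (y * x + y * y)    ≈⟨ +-assoc (x * x) (x * y) _ ⟩
    x * x + (x * y + (y * x + y * y))    ≈⟨ +-congˡ (+-assoc (x * y) (y * x) _) ⟨
    x * x + ((x * y + y * x) + y * y)
      ≈⟨ +-congˡ (+-congʳ (trans (+-congˡ (*-comm y x)) (double≈0 (x * y)))) ⟩
    x * x + (0# + y * y)                 ≈⟨ +-congˡ (+-identityˡ (y * y)) ⟩
    x * x + y * y                        ∎

private
  HasChar2 : CommutativeRing c ℓ → Set ℓ
  HasChar2 A = 1# + 1# ≈ 0#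
    where open CommutativeRing A

  char2-polynomial : (A : CommutativeRing c ℓ) → HasChar2 A →
                     HasChar2 (polynomialRing A)
  char2-polynomial A e = λ where
      .at zero    → e
      .at (suc n) → A.refl
    where
    module A = CommutativeRing A
    open SkewPolynomial A.rawRing id using (at)

  char2-quotient : (A : CommutativeRing c ℓ) (f : CommutativeRing.Carrier A) →
                   HasChar2 A → HasChar2 (A /ᶜ⟨ f ⟩)
  char2-quotient A f = Quotient.≈⇒∼ (CommutativeRing.ring A) f

  char2-ℤ/2 : HasChar2 (ℤ/ 2)
  char2-ℤ/2 = mkCong generator

𝔽₄-frobenius : let open CommutativeRing 𝔽₄ in
               IsRingHomomorphism rawRing rawRing (square ring)
𝔽₄-frobenius = square-isRingHomomorphism 𝔽₄
  (char2-quotient (polynomialRing (ℤ/ 2)) (1+X+X² (CommutativeRing.ring (ℤ/ 2)))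
    (char2-polynomial (ℤ/ 2) char2-ℤ/2))

𝔾₄ : Ring 0ℓ 0ℓ
𝔾₄ = CommutativeRing.ring
  (polynomialRing (ℤ/ 4) /ᶜ⟨ 1+X+X² (CommutativeRing.ring (ℤ/ 4)) ⟩)

𝕊₄ : Ring 0ℓ 0ℓ
𝕊₄ = CommutativeRing.ring
  (polynomialRing 𝔽₄ /ᶜ⟨ X² (CommutativeRing.ring 𝔽₄) ⟩)

𝕋₄ : Ring 0ℓ 0ℓ
𝕋₄ = skewPolynomialRing F (square F) 𝔽₄-frobenius /⟨ X² F ⟩
  where F = CommutativeRing.ring 𝔽₄

freeRightModule : (R : Ring c ℓ) (n : ℕ) → RightModule R c ℓ
freeRightModule R n = record
  { Carrierᴹ = Fin n → Carrier
  ; _≈ᴹ_     = λ v w → ∀ i → v i ≈ w i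
  ; _+ᴹ_     = λ v w i → v i + w i
  ; _*ᵣ_     = λ v r i → v i * r
  ; 0ᴹ       = λ _ → 0#
  ; -ᴹ_      = λ v i → - v i
  ; isRightModule = record
    { isRightSemimodule = record
      { +ᴹ-isCommutativeMonoid = record
        { isMonoid = record
          { isSemigroup = record
            { isMagma = record
              { isEquivalence = record
                { refl = λ _ → refl
                ; sym = λ e i → sym (e i)
                ; trans = λ e f i → trans (e i) (f i) }
              ; ∙-cong = λ e f i → +-cong (e i) (f i) }
            ; assoc = λ u v w i → +-assoc (u i) (v i) (w i) }
          ; identity = (λ v i → +-identityˡ (v i)) , (λ v i → +-identityʳ (v i)) }
        ; comm = λ v w i → +-comm (v i) (w i) }
      ; isPrerightSemimodule = record
        { *ᵣ-cong = λ e f i → *-cong (e i) f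
        ; *ᵣ-zeroʳ = λ v i → zeroʳ (v i)
        ; *ᵣ-distribˡ = λ v r s i → distribˡ (v i) r s
        ; *ᵣ-identityʳ = λ v i → *-identityʳ (v i)
        ; *ᵣ-assoc = λ v r s i → *-assoc (v i) r s
        ; *ᵣ-zeroˡ = λ r i → zeroˡ r
        ; *ᵣ-distribʳ = λ r v w i → distribʳ r (v i) (w i) } }
    ; -ᴹ‿cong = λ e i → -‿cong (e i)
    ; -ᴹ‿inverse = (λ v i → -‿inverseˡ (v i)) , (λ v i → -‿inverseʳ (v i)) } }
  where open Ring R

module _ {R : Ring c ℓ} (M : RightModule R m ℓm) where
  open Ring R using (Carrier; _≈_; 0#)
  open RightModule M

  record Submodule p : Set (c ⊔ m ⊔ ℓm ⊔ lsuc p) where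
    field
      Member : Pred Carrierᴹ p
      resp-≈ : ∀ {v w} → v ≈ᴹ w → Member v → Member w
      0-mem  : Member 0ᴹ
      +-mem  : ∀ {v w} → Member v → Member w → Member (v +ᴹ w)
      *ᵣ-mem : ∀ {v} r → Member v → Member (v *ᵣ r)

  linearCombination : ∀ {k} → (Fin k → Carrierᴹ) → (Fin k → Carrier) → Carrierᴹ
  linearCombination b r = sum +ᴹ-rawMonoid (λ i → b i *ᵣ r i)

  record IsBasis {p k} (N : Submodule p) (b : Fin k → Carrierᴹ) :
                 Set (c ⊔ ℓ ⊔ m ⊔ ℓm ⊔ p) where
    open Submodule N
    field
      basis-mem   : ∀ i → Member (b i)
      spanning    : ∀ {v} → Member v → ∃[ r ] v ≈ᴹ linearCombination b r
      independent : ∀ r → linearCombination b r ≈ᴹ 0ᴹ → ∀ i → r i ≈ 0#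

  IsFreeOfRank : ∀ {p} → ℕ → Submodule p → Set (c ⊔ ℓ ⊔ m ⊔ ℓm ⊔ p)
  IsFreeOfRank k N = ∃[ b ] IsBasis {k = k} N b

  record FreeSubmodule (k : ℕ) p : Set (c ⊔ ℓ ⊔ m ⊔ ℓm ⊔ lsuc p) where
    field
      submodule    : Submodule p
      isFreeOfRank : IsFreeOfRank k submodule
    open Submodule submodule public

record IncidenceStructure a ℓ : Set (lsuc (a ⊔ ℓ)) where
  field
    Point Line : Set a
    _≈ₚ_       : Point → Point → Set ℓ
    _I_        : Point → Line → Set ℓ

-- Two points are identified when they are the same submodule, i.e. have the
-- same elements; the chosen bases play no role.
PHG2 : Ring 0ℓ 0ℓ → IncidenceStructure (lsuc 0ℓ) 0ℓ
PHG2 R = record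
  { Point = FreeSubmodule R³ 1 0ℓ
  ; Line  = FreeSubmodule R³ 2 0ℓ
  ; _≈ₚ_  = λ P Q → Member P ≐ Member Q
  ; _I_   = λ P L → Member P ⊆ Member L
  }
  where
  R³ = freeRightModule R 3
  open FreeSubmodule

module _ {a ℓ} (𝒫 : IncidenceStructure a ℓ) where
  open IncidenceStructure 𝒫

  -- A set of k points is presented by an injective enumeration K.  Incidence
  -- need not be decidable, so "at most n points of K lie on l" says that every
  -- subset of K all of whose members lie on l has cardinality at most n.
  record IsProjectiveArc (k n : ℕ) (K : Fin k → Point) : Set (a ⊔ ℓ) where
    field
      distinct : Injective _≡_ _≈ₚ_ K
      bounded  : ∀ (l : Line) (s : Subset k) →
                 (∀ {i} → i ∈ₛ s → K i I l) → ∣ s ∣ ≤ℕ n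

{-# OPTIONS --safe #-}
module Submission where

-- Each of the three rings is isomorphic to a ring with underlying set 𝔽₄ × 𝔽₄
-- given by explicit tables, in which a non-unit is annihilated by π.  Gaussian
-- elimination on a basis shows that every line lies in the kernel of a
-- covector one of whose entries is 1, so a set of points is a (k , n)-arc as
-- soon as each of the 3 · 16² such covectors vanishes on at most n of its
-- points.  The three sets of 201 points were found by computer search.

open import Defs
open import Algebra.Bundles using (Ring; CommutativeRing; CommutativeMonoid)
open import Algebra.Core using (Op₁; Op₂)
import Algebra.Morphism.Construct.Identity as Identity
open import Algebra.Morphism.Structures using (IsRingHomomorphism; IsRingIsomorphism)
import Algebra.Properties.CommutativeMonoid.Sum as Sum
import Algebra.Properties.CommutativeSemigroup as CommutativeSemigroupProperties
import Algebra.Properties.Ring as RingProperties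
import Algebra.Properties.Semiring.Mult as Multiples
import Algebra.Properties.Semiring.Sum as SemiringSum
open import Data.Bool.Base using (true; false)
open import Data.Fin.Base using (Fin; zero; suc; toℕ; fromℕ<; punchIn; punchOut)
open import Data.Fin.Patterns using (0F; 1F; 2F)
open import Data.Fin.Properties using (all?; any?; _≟_; toℕ-fromℕ<; punchIn-punchOut)
open import Data.Fin.Subset using (Subset; ∣_∣; inside; outside) renaming (_∈_ to _∈ₛ_)
open import Data.Integer.Base as ℤ using (ℤ; +_; -[1+_]; _⊖_)
open import Data.Integer.DivMod using (_%ℕ_; _/ℕ_; a≡a%ℕn+[a/ℕn]*n; n%ℕd<d)
import Data.Integer.Properties as ℤ
open import Data.List.Base using (List; []; _∷_; map)
open import Data.Nat.Base as ℕ using (ℕ; zero; suc; NonZero; z≤n; s≤s) renaming (_≤_ to _≤ℕ_)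
import Data.Nat.Properties as ℕ
open import Data.Product.Base using (_×_; _,_; Σ-syntax; ∃-syntax; proj₁; proj₂; uncurry)
open import Data.Product.Properties using (,-injective) renaming (≡-dec to ×-≡-dec)
open import Data.Sum.Base using (_⊎_; inj₁; inj₂)
open import Data.Sum.Properties using () renaming (≡-dec to ⊎-≡-dec)
open import Data.Vec.Base as Vec using (Vec; []; _∷_; count; lookup)
open import Data.Vec.Functional as Vector using (Vector; insertAt; removeAt)
open import Data.Vec.Functional.Properties using (insertAt-lookup; insertAt-punchIn)
import Data.Vec.Relation.Unary.AllPairs as AllPairs
open import Data.Vec.Relation.Unary.Unique.Propositional using (Unique)
open import Data.Vec.Relation.Unary.Unique.Propositional.Properties using (lookup-injective)
open import Function.Base using (_∘_; _$_; const; id)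
open import Level using (0ℓ)
open import Relation.Binary.Definitions using (DecidableEquality)
open import Relation.Binary.PropositionalEquality as ≡ using (_≡_; _≗_)
import Relation.Binary.Reasoning.Setoid as SetoidReasoning
open import Relation.Nullary.Decidable using (Dec; yes; no; does; map′; ¬?; toWitness; _×-dec_; _⊎-dec_; _→-dec_)
open import Relation.Nullary.Negation using (¬_; contradiction)
open import Relation.Unary using (Pred; Decidable)

-- Quotients of skew polynomial rings

-- Equality in the three rings is congruence modulo an inductively generated ideal, and membership
-- in a line is an arbitrary predicate, so neither can be evaluated. The isomorphisms move all ring
-- computations to a decidable equality, and the covector turns membership into one equation.
-- Inclusion of the line in the kernel is the direction that an upper bound on intersections calls
-- for. Sides matter because 𝕋₄ is not commutative: on a right module, v ↦ Σ hᵢvᵢ is linear with the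
-- coefficients hᵢ on the left, while elimination on the basis uses scalars on the right. The entry
-- 1 of the covector sits at the coordinate left free by the two pivots. Any of the three positions
-- can be left free, hence the factor 3; a line is tested once for each unit entry of its covector,
-- which saves fixing a canonical position.

module _ (R : Ring 0ℓ 0ℓ) where
  open Ring R
  open RingProperties R using (-‿+-comm; -‿involutive)
  open SetoidReasoning setoid

  x-[x-y]≈y : ∀ x y → x - (x - y) ≈ y
  x-[x-y]≈y x y = begin
    x - (x - y)          ≈⟨ +-congˡ (-‿+-comm x (- y)) ⟨
    x + (- x - - y)      ≈⟨ +-assoc _ _ _ ⟨
    (x - x) - - y        ≈⟨ +-cong (-‿inverseʳ x) (-‿involutive y) ⟩
    0# + y               ≈⟨ +-identityˡ y ⟩
    y                    ∎

module _ (S R : Ring 0ℓ 0ℓ) where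
  private
    module S = Ring S
  open Ring R
  open RingProperties R using (x∙y⁻¹≈ε⇒x≈y; +-inverseˡ-unique; +-cancelˡ)

  -- Additive cancellation forces 0# to be preserved, and uniqueness of inverses then forces
  -- negation to be preserved.
  isRingHomomorphism⁺ : (h : S.Carrier → Carrier) →
    (∀ {x y} → x S.≈ y → h x ≈ h y) →
    (∀ x y → h (x S.+ y) ≈ h x + h y) →
    (∀ x y → h (x S.* y) ≈ h x * h y) →
    h S.1# ≈ 1# →
    IsRingHomomorphism S.rawRing rawRing h
  isRingHomomorphism⁺ h h-cong h-+ h-* h-1 = record
    { isSemiringHomomorphism = record
      { isNearSemiringHomomorphism = record
        { +-isMonoidHomomorphism = record
          { isMagmaHomomorphism = record
            { isRelHomomorphism = record { cong = h-cong }
            ; homo = h-+ }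
          ; ε-homo = h-0 }
        ; *-homo = h-* }
      ; 1#-homo = h-1 }
    ; -‿homo = λ x → +-inverseˡ-unique (h (S.- x)) (h x)
        (trans (sym (h-+ (S.- x) x)) (trans (h-cong (S.-‿inverseˡ x)) h-0)) }
    where
    h-0 : h S.0# ≈ 0#
    h-0 = +-cancelˡ (h S.0#) _ _
      (trans (sym (h-+ S.0# S.0#)) (trans (h-cong (S.+-identityˡ S.0#)) (sym (+-identityʳ _))))

  -- The kernel of `h` is a two-sided ideal containing `f`; `vanish` shows this by induction on the
  -- derivation of membership.
  quotient-isRingHomomorphism : ∀ {h} → IsRingHomomorphism S.rawRing rawRing h →
    ∀ {f} → h f ≈ 0# → IsRingHomomorphism (Ring.rawRing (S /⟨ f ⟩)) rawRing h
  quotient-isRingHomomorphism {h} h-hom {f} hf≈0 =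
    record { isSemiringHomomorphism = record
      { isNearSemiringHomomorphism = record
        { +-isMonoidHomomorphism = record
          { isMagmaHomomorphism = record
            { isRelHomomorphism = record { cong = λ {x} {y} x∼y → x∙y⁻¹≈ε⇒x≈y (h x) (h y)
                (trans (+-congˡ (sym (-‿homo y)))
                  (trans (sym (+-homo x (S.- y))) (vanish (difference x∼y)))) }
            ; homo = +-homo }
          ; ε-homo = 0#-homo }
        ; *-homo = *-homo }
      ; 1#-homo = 1#-homo }
    ; -‿homo = -‿homo }
    where
    open IsRingHomomorphism h-hom

    vanish : ∀ {x} → TwoSidedIdeal S.rawRing f x → h x ≈ 0#
    vanish generator      = hf≈0
    vanish zero-mem       = 0#-homo
    vanish (add p q)      = trans (+-homo _ _) (trans (+-cong (vanish p) (vanish q)) (+-identityˡ 0#))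
    vanish (mulˡ r p)     = trans (*-homo _ _) (trans (*-congˡ (vanish p)) (zeroʳ _))
    vanish (mulʳ r p)     = trans (*-homo _ _) (trans (*-congʳ (vanish p)) (zeroˡ _))
    vanish (resp x≈y p)   = trans (⟦⟧-cong (S.sym x≈y)) (vanish p)

-- Integers and residue classes mapped into a ring

module IntegerMultiples (R : Ring 0ℓ 0ℓ) where
  open Ring R
  open RingProperties R using (-0#≈0#; -‿involutive; -‿+-comm; -‿distribʳ-*)
  open CommutativeSemigroupProperties
    (CommutativeMonoid.commutativeSemigroup +-commutativeMonoid) using (interchange)
  open Multiples semiring using (×-homo-+) renaming (_×_ to _×ᴿ_)
  open SetoidReasoning setoid

  -- The canonical homomorphism from ℤ. Elements of `ℤ/ n` are integers as well, so the same
  -- function serves for every `n` with `n ×ᴿ 1# ≈ 0#`.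
  ⟦_⟧ : ℤ → Carrier
  ⟦ + n ⟧      = n ×ᴿ 1#
  ⟦ -[1+ n ] ⟧ = - (suc n ×ᴿ 1#)

  private
    -- Integer addition with opposite signs computes to `⊖`, so this settles the mixed cases of
    -- `⟦⟧-+`.
    ⟦⟧-⊖ : ∀ m n → ⟦ m ⊖ n ⟧ ≈ m ×ᴿ 1# - n ×ᴿ 1#
    ⟦⟧-⊖ zero    zero    = sym (-‿inverseʳ 0#)
    ⟦⟧-⊖ zero    (suc n) = sym (+-identityˡ _)
    ⟦⟧-⊖ (suc m) zero    = sym (trans (+-congˡ -0#≈0#) (+-identityʳ _))
    ⟦⟧-⊖ (suc m) (suc n) = begin
      ⟦ suc m ⊖ suc n ⟧                        ≡⟨ ≡.cong ⟦_⟧ (ℤ.[1+m]⊖[1+n]≡m⊖n m n) ⟩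
      ⟦ m ⊖ n ⟧                                ≈⟨ ⟦⟧-⊖ m n ⟩
      m ×ᴿ 1# - n ×ᴿ 1#                          ≈⟨ +-identityˡ _ ⟨
      0# + (m ×ᴿ 1# - n ×ᴿ 1#)                   ≈⟨ +-congʳ (-‿inverseʳ 1#) ⟨
      (1# - 1#) + (m ×ᴿ 1# - n ×ᴿ 1#)            ≈⟨ interchange _ _ _ _ ⟩
      (1# + m ×ᴿ 1#) + (- 1# - n ×ᴿ 1#)          ≈⟨ +-congˡ (-‿+-comm _ _) ⟩
      (1# + m ×ᴿ 1#) - (1# + n ×ᴿ 1#)            ∎

    ⟦⟧-+ : ∀ i j → ⟦ i ℤ.+ j ⟧ ≈ ⟦ i ⟧ + ⟦ j ⟧
    ⟦⟧-+ (+ m)      (+ n)      = ×-homo-+ 1# m n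
    ⟦⟧-+ (+ m)      -[1+ n ]   = ⟦⟧-⊖ m (suc n)
    ⟦⟧-+ -[1+ m ]   (+ n)      = trans (⟦⟧-⊖ n (suc m)) (+-comm _ _)
    ⟦⟧-+ -[1+ m ]   -[1+ n ]   = begin
      - (1# + (1# + (m ℕ.+ n) ×ᴿ 1#))            ≈⟨ -‿cong (+-congˡ (+-congˡ (×-homo-+ 1# m n))) ⟩
      - (1# + (1# + (m ×ᴿ 1# + n ×ᴿ 1#)))         ≈⟨ -‿cong (+-assoc _ _ _) ⟨
      - ((1# + 1#) + (m ×ᴿ 1# + n ×ᴿ 1#))         ≈⟨ -‿cong (interchange _ _ _ _) ⟩
      - ((1# + m ×ᴿ 1#) + (1# + n ×ᴿ 1#))         ≈⟨ -‿+-comm _ _ ⟨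
      - (1# + m ×ᴿ 1#) - (1# + n ×ᴿ 1#)           ∎

    ⟦⟧-neg : ∀ i → ⟦ ℤ.- i ⟧ ≈ - ⟦ i ⟧
    ⟦⟧-neg (+ zero)   = sym -0#≈0#
    ⟦⟧-neg (+ suc n)  = refl
    ⟦⟧-neg -[1+ n ]   = sym (-‿involutive _)

    -- Induction runs on a natural second factor; additivity absorbs the sign of `i`. Negative
    -- second factors are reached afterwards through `⟦⟧-neg`.
    ⟦⟧-*+ : ∀ i n → ⟦ i ℤ.* + n ⟧ ≈ ⟦ i ⟧ * ⟦ + n ⟧
    ⟦⟧-*+ i zero    = trans (reflexive (≡.cong ⟦_⟧ (ℤ.*-zeroʳ i))) (sym (zeroʳ _))
    ⟦⟧-*+ i (suc n) = begin
      ⟦ i ℤ.* + suc n ⟧              ≡⟨ ≡.cong ⟦_⟧ (ℤ.*-suc i (+ n)) ⟩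
      ⟦ i ℤ.+ i ℤ.* + n ⟧            ≈⟨ ⟦⟧-+ i (i ℤ.* + n) ⟩
      ⟦ i ⟧ + ⟦ i ℤ.* + n ⟧          ≈⟨ +-cong (sym (*-identityʳ _)) (⟦⟧-*+ i n) ⟩
      ⟦ i ⟧ * 1# + ⟦ i ⟧ * ⟦ + n ⟧   ≈⟨ distribˡ _ _ _ ⟨
      ⟦ i ⟧ * (1# + n ×ᴿ 1#)          ∎

    ⟦⟧-* : ∀ i j → ⟦ i ℤ.* j ⟧ ≈ ⟦ i ⟧ * ⟦ j ⟧
    ⟦⟧-* i (+ n)    = ⟦⟧-*+ i n
    ⟦⟧-* i -[1+ n ] = begin
      ⟦ i ℤ.* -[1+ n ] ⟧         ≡⟨ ≡.cong ⟦_⟧ (ℤ.neg-distribʳ-* i (+ suc n)) ⟨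
      ⟦ ℤ.- (i ℤ.* + suc n) ⟧    ≈⟨ ⟦⟧-neg (i ℤ.* + suc n) ⟩
      - ⟦ i ℤ.* + suc n ⟧        ≈⟨ -‿cong (⟦⟧-*+ i (suc n)) ⟩
      - (⟦ i ⟧ * ⟦ + suc n ⟧)    ≈⟨ -‿distribʳ-* _ _ ⟩
      ⟦ i ⟧ * - ⟦ + suc n ⟧      ∎

  ⟦⟧-isRingHomomorphism : ∀ {n} → n ×ᴿ 1# ≈ 0# →
    IsRingHomomorphism (CommutativeRing.rawRing (ℤ/ n)) rawRing ⟦_⟧
  ⟦⟧-isRingHomomorphism = quotient-isRingHomomorphism ℤ-ring R
    (isRingHomomorphism⁺ ℤ-ring R ⟦_⟧ (λ e → reflexive (≡.cong ⟦_⟧ e)) ⟦⟧-+ ⟦⟧-* (+-identityʳ 1#))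
    where ℤ-ring = CommutativeRing.ring ℤ.+-*-commutativeRing

-- Division with remainder gives z - r = qn, which lies in the ideal. Finite checks over `Fin n`
-- thereby speak about all of `ℤ/ n`, whose carrier is infinite.
residue : ∀ n .{{_ : NonZero n}} (z : ℤ) →
          ∃[ i ] CommutativeRing._≈_ (ℤ/ n) z (+ toℕ {n} i)
residue n z = fromℕ< r<n , mkCong (resp (≡.sym difference≡) (mulˡ q generator))
  where
  r = z %ℕ n
  q = z /ℕ n
  r<n = n%ℕd<d z n
  open ≡.≡-Reasoning
  difference≡ : z ℤ.+ ℤ.- (+ toℕ (fromℕ< r<n)) ≡ q ℤ.* + n
  difference≡ = begin
    z ℤ.- + toℕ (fromℕ< r<n)      ≡⟨ ≡.cong (λ m → z ℤ.- + m) (toℕ-fromℕ< r<n) ⟩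
    z ℤ.- + r                     ≡⟨ ≡.cong (ℤ._- + r) (a≡a%ℕn+[a/ℕn]*n z n) ⟩
    (+ r ℤ.+ q ℤ.* + n) ℤ.- + r   ≡⟨ xyx⁻¹≈y (+ r) (q ℤ.* + n) ⟩
    q ℤ.* + n                     ∎
    where open RingProperties (CommutativeRing.ring ℤ.+-*-commutativeRing)

-- Skew polynomials modulo a monic quadratic, evaluated at a root

module QuadraticExtension
  (A : Ring 0ℓ 0ℓ) (σ : Ring.Carrier A → Ring.Carrier A)
  (σ-hom : IsRingHomomorphism (Ring.rawRing A) (Ring.rawRing A) σ)
  (c₀ c₁ : Ring.Carrier A)
  (E : Ring 0ℓ 0ℓ) {θ : Ring.Carrier A → Ring.Carrier E}
  (θ-hom : IsRingHomomorphism (Ring.rawRing A) (Ring.rawRing E) θ)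
  (x : Ring.Carrier E)
  where

  private
    module A = Ring A
    A[X] = skewPolynomialRing A σ σ-hom
    module A[X] = Ring A[X]
    f : List A.Carrier
    f = c₀ ∷ c₁ ∷ A.1# ∷ []
    module Q = Ring (A[X] /⟨ f ⟩)
    open SkewPolynomial A.rawRing σ using (Poly; _≋_; mk≋; at; _⊕_; _⊗_; _·_; X·)
    open SkewPolynomialProperties A σ σ-hom using (⊗-raise)
    open Ring E
    open IsRingHomomorphism θ-hom
    open CommutativeSemigroupProperties
      (CommutativeMonoid.commutativeSemigroup +-commutativeMonoid) using (interchange)

  -- Horner's scheme for Σ θ(aᵢ)xⁱ, with the coefficients on the left of the powers as in the skew
  -- polynomial ring.
  eval : Poly → Carrier
  eval []      = 0#
  eval (a ∷ p) = θ a + eval p * x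

  module _
    (commutation : ∀ a → x * θ a ≈ θ (σ a) * x)
    (root : eval f ≈ 0#)
    where

    private
      open SetoidReasoning setoid

      eval-zero : ∀ p → p ≋ [] → eval p ≈ 0#
      eval-zero []      e = refl
      eval-zero (a ∷ p) e = begin
        θ a + eval p * x     ≈⟨ +-cong (⟦⟧-cong (at e 0)) (*-congʳ (eval-zero p (mk≋ λ n → at e (suc n)))) ⟩
        θ A.0# + 0# * x      ≈⟨ +-cong 0#-homo (zeroˡ x) ⟩
        0# + 0#              ≈⟨ +-identityˡ 0# ⟩
        0#                   ∎

      eval-cong : ∀ p q → p ≋ q → eval p ≈ eval q
      eval-cong []      q       e = sym (eval-zero q (A[X].sym e))
      eval-cong (a ∷ p) []      e = eval-zero (a ∷ p) e
      eval-cong (a ∷ p) (b ∷ q) e =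
        +-cong (⟦⟧-cong (at e 0)) (*-congʳ (eval-cong p q (mk≋ λ n → at e (suc n))))

      eval-⊕ : ∀ p q → eval (p ⊕ q) ≈ eval p + eval q
      eval-⊕ []      q       = sym (+-identityˡ _)
      eval-⊕ (a ∷ p) []      = sym (+-identityʳ _)
      eval-⊕ (a ∷ p) (b ∷ q) = begin
        θ (a A.+ b) + eval (p ⊕ q) * x
          ≈⟨ +-cong (+-homo a b) (trans (*-congʳ (eval-⊕ p q)) (distribʳ x _ _)) ⟩
        (θ a + θ b) + (eval p * x + eval q * x)
          ≈⟨ interchange _ _ _ _ ⟩
        (θ a + eval p * x) + (θ b + eval q * x) ∎

      eval-· : ∀ a q → eval (a · q) ≈ θ a * eval q
      eval-· a []      = sym (zeroʳ _)
      eval-· a (b ∷ q) = begin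
        θ (a A.* b) + eval (a · q) * x
          ≈⟨ +-cong (*-homo a b) (trans (*-congʳ (eval-· a q)) (*-assoc _ _ _)) ⟩
        θ a * θ b + θ a * (eval q * x)   ≈⟨ distribˡ _ _ _ ⟨
        θ a * (θ b + eval q * x)         ∎

      -- The commutation rule enters here: moving `x` from left to right past a coefficient applies
      -- σ to it.
      eval-map-σ : ∀ q → eval (map σ q) * x ≈ x * eval q
      eval-map-σ []      = trans (zeroˡ x) (sym (zeroʳ x))
      eval-map-σ (b ∷ q) = begin
        (θ (σ b) + eval (map σ q) * x) * x        ≈⟨ distribʳ x _ _ ⟩
        θ (σ b) * x + (eval (map σ q) * x) * x
          ≈⟨ +-cong (sym (commutation b)) (trans (*-congʳ (eval-map-σ q)) (*-assoc _ _ _)) ⟩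
        x * θ b + x * (eval q * x)                ≈⟨ distribˡ x _ _ ⟨
        x * (θ b + eval q * x)                    ∎

      eval-X· : ∀ q → eval (X· q) ≈ x * eval q
      eval-X· q = trans (+-congʳ 0#-homo) (trans (+-identityˡ _) (eval-map-σ q))

      eval-⊗ : ∀ p q → eval (p ⊗ q) ≈ eval p * eval q
      eval-⊗ []      q = sym (zeroˡ _)
      eval-⊗ (a ∷ p) q = begin
        eval (a · q ⊕ p ⊗ X· q)              ≈⟨ eval-⊕ (a · q) (p ⊗ X· q) ⟩
        eval (a · q) + eval (p ⊗ X· q)
          ≈⟨ +-cong (eval-· a q) (trans (eval-⊗ p (X· q)) (*-congˡ (eval-X· q))) ⟩
        θ a * eval q + eval p * (x * eval q) ≈⟨ +-congˡ (*-assoc _ _ _) ⟨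
        θ a * eval q + (eval p * x) * eval q ≈⟨ distribʳ _ _ _ ⟨
        (θ a + eval p * x) * eval q          ∎

      eval-one : eval A[X].1# ≈ 1#
      eval-one = trans (+-cong 1#-homo (zeroˡ x)) (+-identityʳ 1#)

      eval-linear : ∀ a b → eval (a ∷ b ∷ []) ≈ θ a + θ b * x
      eval-linear a b = +-congˡ (*-congʳ (trans (+-congˡ (zeroˡ x)) (+-identityʳ _)))

    eval-isRingHomomorphism : IsRingHomomorphism (Ring.rawRing (A[X] /⟨ f ⟩)) rawRing eval
    eval-isRingHomomorphism = quotient-isRingHomomorphism A[X] E
      (isRingHomomorphism⁺ A[X] E eval (λ {p} {q} → eval-cong p q) eval-⊕ eval-⊗ eval-one) root

    private
      module eval = IsRingHomomorphism eval-isRingHomomorphism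

      -- Prepending a coefficient is not a ring operation, so it must be expressed through ring
      -- operations before congruence modulo `f` can be seen to respect it. Multiplication by X on
      -- the right shifts without applying σ.
      ∷-as-sum : ∀ a p → a ∷ p ≋ (a ∷ []) ⊕ p ⊗ (A.0# ∷ A.1# ∷ [])
      ∷-as-sum a p = A[X].sym (A[X].trans
        (A[X].+-congˡ {a ∷ []} (A[X].trans (⊗-raise p A[X].1#) 0∷p1≋0∷p)) a+0∷p≋a∷p)
        where
        0∷p1≋0∷p : A.0# ∷ (p ⊗ A[X].1#) ≋ A.0# ∷ p
        0∷p1≋0∷p .at zero    = A.refl
        0∷p1≋0∷p .at (suc n) = at (A[X].*-identityʳ p) n
        a+0∷p≋a∷p : (a ∷ []) ⊕ (A.0# ∷ p) ≋ a ∷ p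
        a+0∷p≋a∷p .at zero    = A.+-identityʳ a
        a+0∷p≋a∷p .at (suc n) = A.refl

      ∷-cong-∼ : ∀ a {p q} → p Q.≈ q → a ∷ p Q.≈ a ∷ q
      ∷-cong-∼ a {p} {q} p∼q = Q.trans (Quotient.≈⇒∼ A[X] f (∷-as-sum a p))
        (Q.trans (Q.+-congˡ {a ∷ []} (Q.*-congʳ {A.0# ∷ A.1# ∷ []} p∼q))
                 (Q.sym (Quotient.≈⇒∼ A[X] f (∷-as-sum a q))))

      -- The leading coefficient of `f` is 1, and a constant factor d on its left does not bring in
      -- σ, so subtracting d·f removes the term in X².
      reduce-quadratic : ∀ a b d →
        a ∷ b ∷ d ∷ [] Q.≈ (a A.- d A.* c₀) ∷ (b A.- d A.* c₁) ∷ []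
      reduce-quadratic a b d = mkCong (resp d·f≋ (mulˡ (d ∷ []) generator))
        where
        d·f≋ : (d ∷ []) ⊗ f ≋ (a ∷ b ∷ d ∷ []) A[X].- ((a A.- d A.* c₀) ∷ (b A.- d A.* c₁) ∷ [])
        d·f≋ .at 0                   = A.sym (x-[x-y]≈y A a (d A.* c₀))
        d·f≋ .at 1                   = A.sym (x-[x-y]≈y A b (d A.* c₁))
        d·f≋ .at 2                   = A.*-identityʳ d
        d·f≋ .at (suc (suc (suc n))) = A.refl

      -- Division by `f` without tracking degrees: if p ∼ b + dX, then a + pX ∼ a + bX + dX², which
      -- is reduced once more.
      linear-representative : ∀ p → ∃[ a ] ∃[ b ] p Q.≈ a ∷ b ∷ []
      linear-representative []      = A.0# , A.0# , Quotient.≈⇒∼ A[X] f (mk≋ λ where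
        0             → A.refl
        1             → A.refl
        (suc (suc n)) → A.refl)
      linear-representative (a ∷ p) with b , d , p∼b∷d ← linear-representative p =
        _ , _ , Q.trans (∷-cong-∼ a p∼b∷d) (reduce-quadratic a b d)

    -- The hypotheses say that each element of `E` is θ(a) + θ(b)x for exactly one pair of
    -- coefficients. Injectivity follows by comparing linear representatives.
    eval-isRingIsomorphism :
      (∀ a b a′ b′ → θ a + θ b * x ≈ θ a′ + θ b′ * x → a A.≈ a′ × b A.≈ b′) →
      (∀ e → ∃[ a ] ∃[ b ] θ a + θ b * x ≈ e) →
      IsRingIsomorphism (Ring.rawRing (A[X] /⟨ f ⟩)) rawRing eval
    eval-isRingIsomorphism independent spanning = record
      { isRingMonomorphism = record
        { isRingHomomorphism = eval-isRingHomomorphism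
        ; injective = injective }
      ; surjective = λ e → let a , b , ab≈e = spanning e in
          a ∷ b ∷ [] , λ {p} p∼ → trans (eval.⟦⟧-cong p∼) (trans (eval-linear a b) ab≈e) }
      where
      injective : ∀ {p q} → eval p ≈ eval q → p Q.≈ q
      injective {p} {q} ep≈eq
        with a  , b  , p∼ ← linear-representative p
           | a′ , b′ , q∼ ← linear-representative q
        with a≈a′ , b≈b′ ← independent a b a′ b′ (begin
               θ a + θ b * x          ≈⟨ eval-linear a b ⟨
               eval (a ∷ b ∷ [])      ≈⟨ eval.⟦⟧-cong p∼ ⟨
               eval p                 ≈⟨ ep≈eq ⟩
               eval q                 ≈⟨ eval.⟦⟧-cong q∼ ⟩
               eval (a′ ∷ b′ ∷ [])    ≈⟨ eval-linear a′ b′ ⟩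
               θ a′ + θ b′ * x        ∎)
        = Q.trans p∼ (Q.trans (Quotient.≈⇒∼ A[X] f (mk≋ λ where
            0             → a≈a′
            1             → b≈b′
            (suc (suc n)) → A.refl)) (Q.sym q∼))

-- Finite rings given by tables

Exhaustible : Set → Set₁
Exhaustible C = ∀ {P : C → Set} → Decidable P → Dec (∀ x → P x)

×-exhaustible : ∀ {C D} → Exhaustible C → Exhaustible D → Exhaustible (C × D)
×-exhaustible ∀C? ∀D? P? =
  map′ uncurry (λ h c d → h (c , d)) (∀C? λ c → ∀D? λ d → P? (c , d))

module FiniteRing {C : Set} (∀? : Exhaustible C) (_≟_ : DecidableEquality C)
                  (_+_ _*_ : Op₂ C) (-_ : Op₁ C) (0# 1# : C) where

  open import Algebra.Definitions {A = C} _≡_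

  -- Gathered in one decidable proposition, so that the axioms for a concrete table are obtained by
  -- evaluation.
  Laws : Set
  Laws = Associative _+_ × Commutative _+_ × LeftIdentity 0# _+_ × LeftInverse 0# -_ _+_
       × Associative _*_ × Identity 1# _*_ × _*_ DistributesOver _+_

  laws? : Dec Laws
  laws? = assoc? _+_
    ×-dec (∀? λ x → ∀? λ y → (x + y) ≟ (y + x))
    ×-dec (∀? λ x → (0# + x) ≟ x)
    ×-dec (∀? λ x → ((- x) + x) ≟ 0#)
    ×-dec assoc? _*_
    ×-dec ((∀? λ x → (1# * x) ≟ x) ×-dec (∀? λ x → (x * 1#) ≟ x))
    ×-dec ((∀? λ x → ∀? λ y → ∀? λ z → (x * (y + z)) ≟ ((x * y) + (x * z)))
     ×-dec (∀? λ x → ∀? λ y → ∀? λ z → ((y + z) * x) ≟ ((y * x) + (z * x))))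
    where
    assoc? : (_∙_ : Op₂ C) → Dec (Associative _∙_)
    assoc? _∙_ = ∀? λ x → ∀? λ y → ∀? λ z → ((x ∙ y) ∙ z) ≟ (x ∙ (y ∙ z))

  ring : Laws → Ring 0ℓ 0ℓ
  ring (+-assoc , +-comm , +-identityˡ , -‿inverseˡ , *-assoc , *-identity , distrib) = record
    { isRing = record
      { +-isAbelianGroup = record
        { isGroup = record
          { isMonoid = record
            { isSemigroup = record
              { isMagma = record { isEquivalence = ≡.isEquivalence ; ∙-cong = ≡.cong₂ _+_ }
              ; assoc = +-assoc }
            ; identity = +-identityˡ , λ x → ≡.trans (+-comm x 0#) (+-identityˡ x) }
          ; inverse = -‿inverseˡ , λ x → ≡.trans (+-comm x (- x)) (-‿inverseˡ x)
          ; ⁻¹-cong = ≡.cong -_ }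
        ; comm = +-comm }
      ; *-cong = ≡.cong₂ _*_
      ; *-assoc = *-assoc
      ; *-identity = *-identity
      ; distrib = distrib } }

-- The field with four elements and the chain rings over it

F₄ : Set
F₄ = Fin 4

pattern O = zero
pattern I = suc zero
pattern ω = suc (suc zero)
pattern ω̄ = suc (suc (suc zero))

infixl 6 _+₄_
_+₄_ : Op₂ F₄
O +₄ b = b
I +₄ O = I
I +₄ I = O
I +₄ ω = ω̄
I +₄ ω̄ = ω
ω +₄ O = ω
ω +₄ I = ω̄
ω +₄ ω = O
ω +₄ ω̄ = I
ω̄ +₄ O = ω̄
ω̄ +₄ I = ω
ω̄ +₄ ω = I
ω̄ +₄ ω̄ = O

infixl 7 _*₄_
_*₄_ : Op₂ F₄
O *₄ b = O
I *₄ b = b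
ω *₄ O = O
ω *₄ I = ω
ω *₄ ω = ω̄
ω *₄ ω̄ = I
ω̄ *₄ O = O
ω̄ *₄ I = ω̄
ω̄ *₄ ω = I
ω̄ *₄ ω̄ = ω

square₄ : Op₁ F₄
square₄ a = a *₄ a

module 𝔽 = FiniteRing all? _≟_ _+₄_ _*₄_ id O I

𝔽-laws : 𝔽.Laws
𝔽-laws = toWitness {a? = 𝔽.laws?} _

E : Set
E = F₄ × F₄

_≟E_ : DecidableEquality E
_≟E_ = ×-≡-dec _≟_ _≟_

∀E? : Exhaustible E
∀E? = ×-exhaustible all? all?

-- The pair (a , b) stands for [a] + [b]π, where [a] is the Teichmüller
-- representative of a and π generates the radical (π = 2 in 𝔾₄, π = X in 𝕊₄ and
-- 𝕋₄); the parameters are determined by π[a] = [σ a]π and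
-- [a] + [c] = [a + c] + [κ a c]π.
module Chain (σ : Op₁ F₄) (κ : Op₂ F₄) where
  infixl 6 _+_
  infixl 7 _*_
  _+_ _*_ : Op₂ E
  (a , b) + (c , d) = a +₄ c , (b +₄ d) +₄ κ a c
  (a , b) * (c , d) = a *₄ c , (a *₄ d) +₄ (b *₄ σ c)

  -- Adding (a , b) to itself leaves (O , κ a a), and the extra summand cancels this carry. For
  -- `wittCarry` it is a⁴ = a, in accordance with -[a] = [a] + 2[a] in 𝔾₄.
  -_ : Op₁ E
  - (a , b) = a , b +₄ κ a a

  open FiniteRing ∀E? _≟E_ _+_ _*_ -_ (O , O) (I , O) public

noCarry : Op₂ F₄
noCarry a c = O

-- In 𝔾₄ one has [a] + [c] = [a + c] + 2[√(ac)], and √b = b² in 𝔽₄.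
wittCarry : Op₂ F₄
wittCarry a c = square₄ (a *₄ c)

module G = Chain id      wittCarry
module S = Chain id      noCarry
module T = Chain square₄ noCarry

G-laws : G.Laws
G-laws = toWitness {a? = G.laws?} _

S-laws : S.Laws
S-laws = toWitness {a? = S.laws?} _

T-laws : T.Laws
T-laws = toWitness {a? = T.laws?} _

-- Table models of 𝔽₄, 𝔾₄, 𝕊₄ and 𝕋₄

id-hom : (A : CommutativeRing 0ℓ 0ℓ) →
         let open CommutativeRing A in IsRingHomomorphism rawRing rawRing id
id-hom A = Identity.isRingHomomorphism (CommutativeRing.rawRing A) (CommutativeRing.refl A)

-- Serves both 𝔽₄ (n = 2) and 𝔾₄ (n = 4), which are quotients of (ℤ/n)[X] by the same polynomial.
module GaloisExtension
  {C : Set} (∀? : Exhaustible C) (_≟ᶜ_ : DecidableEquality C)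
  (_+_ _*_ : Op₂ C) (-_ : Op₁ C) (0# 1# : C)
  (laws : FiniteRing.Laws ∀? _≟ᶜ_ _+_ _*_ -_ 0# 1#)
  (n : ℕ) .{{_ : NonZero n}} (x : C)
  where

  private
    E-ring = FiniteRing.ring ∀? _≟ᶜ_ _+_ _*_ -_ 0# 1# laws
    module ℤ/n = CommutativeRing (ℤ/ n)
  open IntegerMultiples E-ring

  -- Coefficients are taken in `Fin n` so that independence and spanning become finite checks;
  -- `residue` extends them to integer coefficients.
  linear : Fin n → Fin n → C
  linear i j = ⟦ + toℕ i ⟧ + (⟦ + toℕ j ⟧ * x)

  -- The third condition is 1 + x + x² = 0 in the form in which 1+X+X² is evaluated.
  Conditions : Set
  Conditions = ⟦ + n ⟧ ≡ 0#
             × (∀ c → x * c ≡ c * x)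
             × ⟦ + 1 ⟧ + ((⟦ + 1 ⟧ + ((⟦ + 1 ⟧ + (0# * x)) * x)) * x) ≡ 0#
             × (∀ i j i′ j′ → linear i j ≡ linear i′ j′ → i ≡ i′ × j ≡ j′)
             × (∀ c → ∃[ i ] ∃[ j ] linear i j ≡ c)

  conditions? : Dec Conditions
  conditions? = (_ ≟ᶜ _)
    ×-dec (∀? λ c → _ ≟ᶜ _)
    ×-dec (_ ≟ᶜ _)
    ×-dec (all? λ i → all? λ j → all? λ i′ → all? λ j′ →
             (linear i j ≟ᶜ linear i′ j′) →-dec ((i ≟ i′) ×-dec (j ≟ j′)))
    ×-dec (∀? λ c → any? λ i → any? λ j → linear i j ≟ᶜ c)

  module _ (conditions : Conditions) where
    private
      char       = proj₁ conditions
      central    = proj₁ (proj₂ conditions)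
      root       = proj₁ (proj₂ (proj₂ conditions))
      linear-inj = proj₁ (proj₂ (proj₂ (proj₂ conditions)))
      spanning   = proj₂ (proj₂ (proj₂ (proj₂ conditions)))
      ⟦⟧-hom = ⟦⟧-isRingHomomorphism {n} char
      open IsRingHomomorphism ⟦⟧-hom using (⟦⟧-cong)

    module Extension =
      QuadraticExtension ℤ/n.ring id (id-hom (ℤ/ n)) ℤ/n.1# ℤ/n.1# E-ring ⟦⟧-hom x

    private
      reduce : ∀ {a b i j} → a ℤ/n.≈ + toℕ i → b ℤ/n.≈ + toℕ j →
               ⟦ a ⟧ + (⟦ b ⟧ * x) ≡ linear i j
      reduce a∼i b∼j = ≡.cong₂ (λ u v → u + (v * x)) (⟦⟧-cong a∼i) (⟦⟧-cong b∼j)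

      independent : ∀ a b a′ b′ → ⟦ a ⟧ + (⟦ b ⟧ * x) ≡ ⟦ a′ ⟧ + (⟦ b′ ⟧ * x) →
                    a ℤ/n.≈ a′ × b ℤ/n.≈ b′
      independent a b a′ b′ e
        with i , a∼i ← residue n a | j , b∼j ← residue n b
           | i′ , a′∼i′ ← residue n a′ | j′ , b′∼j′ ← residue n b′
        with ≡.refl , ≡.refl ← linear-inj i j i′ j′
               (≡.trans (≡.sym (reduce a∼i b∼j)) (≡.trans e (reduce a′∼i′ b′∼j′)))
        = ℤ/n.trans a∼i (ℤ/n.sym a′∼i′) , ℤ/n.trans b∼j (ℤ/n.sym b′∼j′)

    isRingIsomorphism : IsRingIsomorphism
      (CommutativeRing.rawRing (polynomialRing (ℤ/ n) /ᶜ⟨ 1+X+X² ℤ/n.ring ⟩))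
      (Ring.rawRing E-ring) Extension.eval
    isRingIsomorphism = Extension.eval-isRingIsomorphism (λ a → central ⟦ a ⟧) root independent
      (λ c → let i , j , e = spanning c in + toℕ i , + toℕ j , e)

module 𝔽₄-Extension = GaloisExtension all? _≟_ _+₄_ _*₄_ id O I 𝔽-laws 2 ω
-- The Teichmüller representative [ω] has order 3 and [ω] - 1 is a unit, so 1 + [ω] + [ω]² vanishes
-- exactly and not just modulo 2.
module 𝔾₄-Extension = GaloisExtension ∀E? _≟E_ G._+_ G._*_ G.-_ (O , O) (I , O) G-laws 4 (ω , O)

𝔽₄-conditions : 𝔽₄-Extension.Conditions
𝔽₄-conditions = toWitness {a? = 𝔽₄-Extension.conditions?} _

𝔾₄-conditions : 𝔾₄-Extension.Conditions
𝔾₄-conditions = toWitness {a? = 𝔾₄-Extension.conditions?} _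

𝔽₄≅ : IsRingIsomorphism (CommutativeRing.rawRing 𝔽₄) (Ring.rawRing (𝔽.ring 𝔽-laws)) _
𝔽₄≅ = 𝔽₄-Extension.isRingIsomorphism 𝔽₄-conditions

𝔾₄≅ : IsRingIsomorphism (Ring.rawRing 𝔾₄) (Ring.rawRing (G.ring G-laws)) _
𝔾₄≅ = 𝔾₄-Extension.isRingIsomorphism 𝔾₄-conditions

module EqualCharacteristic
  (τ : Op₁ F₄) (laws : Chain.Laws τ noCarry)
  (s : Op₁ (CommutativeRing.Carrier 𝔽₄))
  (s-hom : IsRingHomomorphism (CommutativeRing.rawRing 𝔽₄) (CommutativeRing.rawRing 𝔽₄) s)
  where

  private
    module F = CommutativeRing 𝔽₄
    module φ = IsRingIsomorphism 𝔽₄≅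
    φ = 𝔽₄-Extension.Extension.eval 𝔽₄-conditions
  open Chain τ noCarry

  ι : F₄ → E
  ι a = a , O

  -- The third condition yields independence and spanning at once. The last one is π² = 0 in the
  -- form in which `X²` is evaluated.
  Conditions : Set
  Conditions = (∀ a b → ι (a +₄ b) ≡ ι a + ι b)
             × (∀ a b → ι (a *₄ b) ≡ ι a * ι b)
             × (∀ a b → ι a + ι b * (O , I) ≡ (a , b))
             × (∀ a → (O , I) * ι a ≡ ι (τ a) * (O , I))
             × ι O + (ι O + (ι I + (O , O) * (O , I)) * (O , I)) * (O , I) ≡ (O , O)

  conditions? : Dec Conditions
  conditions? = (all? λ a → all? λ b → _ ≟E _)
          ×-dec (all? λ a → all? λ b → _ ≟E _)
          ×-dec (all? λ a → all? λ b → _ ≟E _)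
          ×-dec (all? λ a → _ ≟E _)
          ×-dec (_ ≟E _)

  module _ (conditions : Conditions) (φ∘s : ∀ a → φ (s a) ≡ τ (φ a)) where
    private
      ι-+    = proj₁ conditions
      ι-*    = proj₁ (proj₂ conditions)
      split  = proj₁ (proj₂ (proj₂ conditions))
      commutation = proj₁ (proj₂ (proj₂ (proj₂ conditions)))
      root = proj₂ (proj₂ (proj₂ (proj₂ conditions)))

      ιφ-hom : IsRingHomomorphism F.rawRing (Ring.rawRing (ring laws)) (λ a → ι (φ a))
      ιφ-hom = isRingHomomorphism⁺ F.ring (ring laws) (λ a → ι (φ a))
        (λ e → ≡.cong ι (φ.⟦⟧-cong e))
        (λ a b → ≡.trans (≡.cong ι (φ.+-homo a b)) (ι-+ (φ a) (φ b)))
        (λ a b → ≡.trans (≡.cong ι (φ.*-homo a b)) (ι-* (φ a) (φ b)))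
        (≡.cong ι φ.1#-homo)

    module Extension =
      QuadraticExtension F.ring s s-hom F.0# F.0# (ring laws) ιφ-hom (O , I)

    isRingIsomorphism : IsRingIsomorphism
      (Ring.rawRing (skewPolynomialRing F.ring s s-hom /⟨ X² F.ring ⟩))
      (Ring.rawRing (ring laws)) Extension.eval
    isRingIsomorphism = Extension.eval-isRingIsomorphism
      (λ a → ≡.trans (commutation (φ a)) (≡.cong (λ b → ι b * (O , I)) (≡.sym (φ∘s a))))
      root
      (λ a b a′ b′ e →
        let a≡a′ , b≡b′ = ,-injective (≡.trans (≡.sym (split _ _)) (≡.trans e (split _ _)))
        in φ.injective a≡a′ , φ.injective b≡b′)
      (λ (a , b) → let a⁻ , φa⁻≡a = φ.surjective a ; b⁻ , φb⁻≡b = φ.surjective b in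
        a⁻ , b⁻ , ≡.trans
          (≡.cong₂ (λ u v → ι u + ι v * (O , I)) (φa⁻≡a F.refl) (φb⁻≡b F.refl)) (split a b))

module 𝕊₄-Extension = EqualCharacteristic id S-laws id (id-hom 𝔽₄)
module 𝕋₄-Extension = EqualCharacteristic square₄ T-laws (square (CommutativeRing.ring 𝔽₄)) 𝔽₄-frobenius

𝕊₄≅ : IsRingIsomorphism (Ring.rawRing 𝕊₄) (Ring.rawRing (S.ring S-laws)) _
𝕊₄≅ = 𝕊₄-Extension.isRingIsomorphism
  (toWitness {a? = 𝕊₄-Extension.conditions?} _) (λ _ → ≡.refl)

𝕋₄≅ : IsRingIsomorphism (Ring.rawRing 𝕋₄) (Ring.rawRing (T.ring T-laws)) _
𝕋₄≅ = 𝕋₄-Extension.isRingIsomorphism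
  -- Squaring in 𝔽₄ corresponds to `square₄` because the isomorphism is multiplicative.
  (toWitness {a? = 𝕋₄-Extension.conditions?} _) (λ a → IsRingIsomorphism.*-homo 𝔽₄≅ a a)

-- Points and lines of the Hjelmslev plane

-- Links the definition of an arc, which quantifies over subsets, with a number that evaluates.
-- Positions outside `s` may also satisfy `P`, hence an inequality.
∣s∣≤count : ∀ {A : Set} {P : Pred A 0ℓ} (P? : Decidable P) {n} (xs : Vec A n) (s : Subset n) →
            (∀ {i} → i ∈ₛ s → P (lookup xs i)) → ∣ s ∣ ≤ℕ count P? xs
∣s∣≤count P? []       []            h = z≤n
∣s∣≤count P? (x ∷ xs) (outside ∷ s) h with ih ← ∣s∣≤count P? xs s (h ∘ Vec.there) | does (P? x)
... | true  = ℕ.m≤n⇒m≤1+n ih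
... | false = ih
∣s∣≤count P? (x ∷ xs) (inside ∷ s) h with P? x
... | yes _ = s≤s (∣s∣≤count P? xs s (h ∘ Vec.there))
... | no ¬p = contradiction (h Vec.here) ¬p

module DotProduct (R : Ring 0ℓ 0ℓ) where
  open Ring R
  open Sum +-commutativeMonoid public using (sum; sum-cong-≋; sum-remove; ∑-distrib-+)
  open SemiringSum semiring using (*-distribʳ-sum)

  dot : ∀ {n} → Vector Carrier n → Vector Carrier n → Carrier
  dot h v = sum λ i → h i * v i

  dot-congˡ : ∀ {n} (h : Vector Carrier n) {v w} → (∀ i → v i ≈ w i) → dot h v ≈ dot h w
  dot-congˡ h e = sum-cong-≋ λ i → *-congˡ (e i)

  dot-+ : ∀ {n} (h v w : Vector Carrier n) → dot h (λ i → v i + w i) ≈ dot h v + dot h w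
  dot-+ h v w = trans (sum-cong-≋ λ i → distribˡ (h i) (v i) (w i))
    (∑-distrib-+ (λ i → h i * v i) (λ i → h i * w i))

  dot-* : ∀ {n} (h v : Vector Carrier n) r → dot h (λ i → v i * r) ≈ dot h v * r
  dot-* h v r = trans (sum-cong-≋ λ i → sym (*-assoc (h i) (v i) r))
    (sym (*-distribʳ-sum r (λ i → h i * v i)))

-- Every line lies in the kernel of a covector

module _ (R : Ring 0ℓ 0ℓ) where
  open Ring R

  Unit : Carrier → Set
  Unit x = ∃[ y ] x * y ≈ 1# × y * x ≈ 1#

  -- In a chain ring of length 2 the non-units form the radical, whose square is zero. The factor π
  -- stands on the right because bases of right modules are tested with right scalars.
  NonUnitsAnnihilatedBy : Carrier → Set
  NonUnitsAnnihilatedBy π = ∀ x → Unit x ⊎ x * π ≈ 0#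

module Lines (R : Ring 0ℓ 0ℓ) (π : Ring.Carrier R) (π≉0 : ¬ Ring._≈_ R π (Ring.0# R))
  (unit⊎annihilated : NonUnitsAnnihilatedBy R π)
  where

  open Ring R hiding (zero)
  open DotProduct R
  open RingProperties R using (-‿distribˡ-*; -‿distribʳ-*)
  open SetoidReasoning setoid

  private
    -- A vector not killed by π has a unit entry. The search is constructive because the dichotomy
    -- decides each entry in turn.
    unit-entry : ∀ {n} (v : Vector Carrier n) → ¬ (∀ i → v i * π ≈ 0#) → ∃[ i ] Unit R (v i)
    unit-entry {zero}  v ¬ann = contradiction (λ ()) ¬ann
    unit-entry {suc n} v ¬ann with unit⊎annihilated (v zero)
    ... | inj₁ unit = zero , unit
    ... | inj₂ v₀π≈0 with i , unit ← unit-entry (v ∘ suc)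
            (λ ann → ¬ann λ { zero → v₀π≈0 ; (suc i) → ann i }) = suc i , unit

  module _ (u w : Vector Carrier 3)
    (independent : ∀ r s → (∀ i → u i * r + w i * s ≈ 0#) → r ≈ 0# × s ≈ 0#)
    where

    private
      -- Otherwise uπ + w0 = 0 would be a relation with the nonzero coefficient π.
      u-unit : ∃[ i ] Unit R (u i)
      u-unit = unit-entry u λ ann → π≉0 $ proj₁ $ independent π 0# λ i →
        trans (+-cong (ann i) (zeroʳ (w i))) (+-identityˡ 0#)

      i = proj₁ u-unit
      a = proj₁ (proj₂ u-unit)
      uᵢa≈1 = proj₁ (proj₂ (proj₂ u-unit))
      auᵢ≈1 = proj₂ (proj₂ (proj₂ u-unit))

      -- Chosen so that w′ = ut + w vanishes at the pivot i; this uses `a` as a right inverse of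
      -- `u i`.
      t = - (a * w i)

      w′ : Vector Carrier 3
      w′ l = u l * t + w l

      w′ᵢ≈0 : w′ i ≈ 0#
      w′ᵢ≈0 = begin
        u i * - (a * w i) + w i      ≈⟨ +-congʳ (-‿distribʳ-* _ _) ⟨
        - (u i * (a * w i)) + w i    ≈⟨ +-congʳ (-‿cong (*-assoc _ _ _)) ⟨
        - ((u i * a) * w i) + w i    ≈⟨ +-congʳ (-‿cong (trans (*-congʳ uᵢa≈1) (*-identityˡ _))) ⟩
        - w i + w i                  ≈⟨ -‿inverseˡ _ ⟩
        0#                           ∎

      -- If π killed w′ off the pivot it would kill all of w′, and w′π = u(tπ) + wπ would be a
      -- relation with coefficient π at w.
      w′-unit : ∃[ j ] Unit R (w′ (punchIn i j))
      w′-unit = unit-entry (removeAt w′ i) λ ann → π≉0 $ proj₂ $ independent (t * π) π λ l →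
        begin
          u l * (t * π) + w l * π   ≈⟨ +-congʳ (*-assoc _ _ _) ⟨
          (u l * t) * π + w l * π   ≈⟨ distribʳ π _ _ ⟨
          w′ l * π                  ≈⟨ annihilated ann l ⟩
          0#                        ∎
        where
        annihilated : (∀ j → w′ (punchIn i j) * π ≈ 0#) → ∀ l → w′ l * π ≈ 0#
        annihilated ann l with i ≟ l
        ... | yes ≡.refl = trans (*-congʳ w′ᵢ≈0) (zeroˡ π)
        ... | no i≢l = ≡.subst (λ m → w′ m * π ≈ 0#) (punchIn-punchOut i≢l) (ann (punchOut i≢l))

      j′ = proj₁ w′-unit
      b = proj₁ (proj₂ w′-unit)
      bw′ⱼ≈1 = proj₂ (proj₂ (proj₂ w′-unit))

      j = punchIn i j′
      k = punchIn i (punchIn j′ zero)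

      -- Back substitution from the value 1 at k: since w′ᵢ vanishes, orthogonality to w′ fixes hⱼ,
      -- and orthogonality to u then fixes hᵢ. The coefficients stand on the left, so left inverses
      -- of the pivots are used.
      hⱼ = - (w′ k * b)
      hᵢ = - ((hⱼ * u j + u k) * a)

      h : Vector Carrier 3
      h = insertAt (insertAt (const 1#) j′ hⱼ) i hᵢ

      h-i : h i ≡ hᵢ
      h-i = insertAt-lookup _ i hᵢ

      h-j : h j ≡ hⱼ
      h-j = ≡.trans (insertAt-punchIn _ i hᵢ j′) (insertAt-lookup _ j′ hⱼ)

      h-k : h k ≡ 1#
      h-k = ≡.trans (insertAt-punchIn _ i hᵢ _) (insertAt-punchIn _ j′ hⱼ zero)

      dot-h : ∀ v → dot h v ≈ hᵢ * v i + (hⱼ * v j + v k)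
      dot-h v = begin
        dot h v
          ≈⟨ sum-remove {i = i} (λ l → h l * v l) ⟩
        h i * v i + sum (λ l → h (punchIn i l) * v (punchIn i l))
          ≈⟨ +-congˡ (sum-remove {i = j′} (λ l → h (punchIn i l) * v (punchIn i l))) ⟩
        h i * v i + (h j * v j + (h k * v k + 0#))
          ≈⟨ +-cong (*-congʳ (reflexive h-i)) (+-cong (*-congʳ (reflexive h-j))
               (trans (+-identityʳ _) (trans (*-congʳ (reflexive h-k)) (*-identityˡ _)))) ⟩
        hᵢ * v i + (hⱼ * v j + v k) ∎

      cancel : ∀ {x y z} → z * x ≈ 1# → - (y * z) * x + y ≈ 0#
      cancel {x} {y} {z} zx≈1 = begin
        - (y * z) * x + y      ≈⟨ +-congʳ (-‿distribˡ-* _ _) ⟨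
        - ((y * z) * x) + y    ≈⟨ +-congʳ (-‿cong (*-assoc _ _ _)) ⟩
        - (y * (z * x)) + y    ≈⟨ +-congʳ (-‿cong (trans (*-congˡ zx≈1) (*-identityʳ y))) ⟩
        - y + y                ≈⟨ -‿inverseˡ y ⟩
        0#                     ∎

      hu≈0 : dot h u ≈ 0#
      hu≈0 = trans (dot-h u) (cancel auᵢ≈1)

      hw′≈0 : dot h w′ ≈ 0#
      hw′≈0 = begin
        dot h w′                            ≈⟨ dot-h w′ ⟩
        hᵢ * w′ i + (hⱼ * w′ j + w′ k)      ≈⟨ +-cong (trans (*-congˡ w′ᵢ≈0) (zeroʳ _)) (cancel bw′ⱼ≈1) ⟩
        0# + 0#                             ≈⟨ +-identityˡ 0# ⟩
        0#                                  ∎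

      -- Since `h` kills u, adding ut to w does not change the value, and `h` kills w′.
      hw≈0 : dot h w ≈ 0#
      hw≈0 = begin
        dot h w                              ≈⟨ +-identityˡ _ ⟨
        0# + dot h w                         ≈⟨ +-congʳ (trans (*-congʳ hu≈0) (zeroˡ t)) ⟨
        dot h u * t + dot h w                ≈⟨ +-congʳ (dot-* h u t) ⟨
        dot h (λ l → u l * t) + dot h w      ≈⟨ dot-+ h (λ l → u l * t) w ⟨
        dot h w′                             ≈⟨ hw′≈0 ⟩
        0#                                   ∎

    annihilating-covector : ∃[ h ] ∃[ k ] h k ≈ 1# × dot h u ≈ 0# × dot h w ≈ 0#
    annihilating-covector = h , k , reflexive h-k , hu≈0 , hw≈0

  line-covector : (l : FreeSubmodule (freeRightModule R 3) 2 0ℓ) →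
    ∃[ h ] ∃[ k ] h k ≈ 1# × (∀ {v} → FreeSubmodule.Member l v → dot h v ≈ 0#)
  line-covector l =
    let h , k , hₖ≈1 , hu≈0 , hw≈0 = annihilating-covector u w independent₂ in
    h , k , hₖ≈1 , λ {v} v∈l → let r , v≈ = spanning v∈l in begin
        dot h v
          ≈⟨ dot-congˡ h (λ i → trans (v≈ i) (+-congˡ (+-identityʳ _))) ⟩
        dot h (λ i → u i * r 0F + w i * r 1F)
          ≈⟨ trans (dot-+ h (λ i → u i * r 0F) (λ i → w i * r 1F)) (+-cong (dot-* h u _) (dot-* h w _)) ⟩
        dot h u * r 0F + dot h w * r 1F
          ≈⟨ +-cong (trans (*-congʳ hu≈0) (zeroˡ _)) (trans (*-congʳ hw≈0) (zeroˡ _)) ⟩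
        0# + 0#
          ≈⟨ +-identityˡ 0# ⟩
        0# ∎
    where
    open FreeSubmodule l using (isFreeOfRank)
    open IsBasis (proj₂ isFreeOfRank)
    u = proj₁ isFreeOfRank zero
    w = proj₁ isFreeOfRank 1F
    independent₂ : ∀ r s → (∀ i → u i * r + w i * s ≈ 0#) → r ≈ 0# × s ≈ 0#
    independent₂ r s e = r,s≈0 zero , r,s≈0 1F
      where
      r,s≈0 = independent (λ { zero → r ; 1F → s })
                          (λ i → trans (+-congˡ (+-identityʳ _)) (e i))

-- Homogeneous coordinates scaled so that the first unit entry is 1.
Point : Set
Point = (E × E) ⊎ (F₄ × E) ⊎ (F₄ × F₄)

pattern 1∶_,_∶_,_ a b c d = inj₁ ((a , b) , (c , d))
pattern π_∶1∶_,_ a c d = inj₂ (inj₁ (a , (c , d)))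
pattern π_∶π_∶1 a b = inj₂ (inj₂ (a , b))

_≟ₚ_ : DecidableEquality Point
_≟ₚ_ = ⊎-≡-dec (×-≡-dec _≟E_ _≟E_) (⊎-≡-dec (×-≡-dec _≟_ _≟E_) _≟E_)

vector : E → E → E → Vector E 3
vector x y z = x Vector.∷ y Vector.∷ z Vector.∷ Vector.[]

coordinates : Point → Vector E 3
coordinates (1∶ a , b ∶ c , d) = vector (I , O) (a , b) (c , d)
coordinates (π a ∶1∶ c , d)    = vector (O , a) (I , O) (c , d)
coordinates (π a ∶π b ∶1)      = vector (O , a) (O , b) (I , O)

coordinates-1 : ∀ P → ∃[ i ] coordinates P i ≡ (I , O)
coordinates-1 (1∶ _ , _ ∶ _ , _) = zero , ≡.refl
coordinates-1 (π _ ∶1∶ _ , _)    = 1F , ≡.refl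
coordinates-1 (π _ ∶π _ ∶1)      = 2F , ≡.refl

*₄-zeroʳ : ∀ a → a *₄ O ≡ O
*₄-zeroʳ = toWitness {a? = all? λ a → a *₄ O ≟ O} _

-- Arcs over the table rings and their transfer along isomorphisms

module ChainRingPlane (τ : Op₁ F₄) (κ : Op₂ F₄) (laws : Chain.Laws τ κ) where
  open Chain τ κ

  chainRing : Ring 0ℓ 0ℓ
  chainRing = ring laws

  private
    module E = Ring chainRing
  open DotProduct chainRing

  -- If P and Q have their normalising 1 in the same place, that entry forces r = 1. If that of P
  -- comes earlier, the entry of Q there has residue O. If it comes later, r itself has residue O,
  -- which contradicts the entry 1 of P.
  coordinates-proportional⇒≡ : ∀ P Q r → (∀ i → coordinates P i ≡ coordinates Q i * r) → P ≡ Q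
  coordinates-proportional⇒≡ P Q r e = compare P Q e
    where
    same : ∀ P Q (i : Fin 3) → (∀ i → coordinates P i ≡ coordinates Q i * r) →
           coordinates P i ≡ (I , O) → coordinates Q i ≡ (I , O) → coordinates P ≗ coordinates Q
    same P Q i e Pᵢ≡1 Qᵢ≡1 j = ≡.trans (e j)
      (≡.trans (≡.cong (coordinates Q j *_) r≡1) (E.*-identityʳ _))
      where
      r≡1 : r ≡ (I , O)
      r≡1 = ≡.trans (≡.sym (E.*-identityˡ r))
        (≡.trans (≡.cong (_* r) (≡.sym Qᵢ≡1)) (≡.trans (≡.sym (e i)) Pᵢ≡1))

    absurd : ∀ {A : Set} {a b c} → (O , a) ≡ (I , O) * r → (I , O) ≡ (b , c) * r → A
    absurd {b = b} e₁ e₂ with () ← ≡.trans (≡.cong proj₁ e₂)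
      (≡.trans (≡.cong (b *₄_) (≡.sym (≡.cong proj₁ e₁))) (*₄-zeroʳ b))

    compare : ∀ P Q → (∀ i → coordinates P i ≡ coordinates Q i * r) → P ≡ Q
    compare P@(1∶ _ , _ ∶ _ , _) Q@(1∶ _ , _ ∶ _ , _) e =
      let c = same P Q zero e ≡.refl ≡.refl in
      ≡.cong₂ (λ y z → inj₁ (y , z)) (c 1F) (c 2F)
    compare P@(π _ ∶1∶ _ , _) Q@(π _ ∶1∶ _ , _) e =
      let c = same P Q 1F e ≡.refl ≡.refl in
      ≡.cong₂ (λ x z → inj₂ (inj₁ (proj₂ x , z))) (c zero) (c 2F)
    compare P@(π _ ∶π _ ∶1) Q@(π _ ∶π _ ∶1) e =
      let c = same P Q 2F e ≡.refl ≡.refl in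
      ≡.cong₂ (λ x y → inj₂ (inj₂ (proj₂ x , proj₂ y))) (c zero) (c 1F)
    compare (1∶ _ , _ ∶ _ , _) (π _ ∶1∶ _ , _) e with () ← ≡.cong proj₁ (e zero)
    compare (1∶ _ , _ ∶ _ , _) (π _ ∶π _ ∶1)   e with () ← ≡.cong proj₁ (e zero)
    compare (π _ ∶1∶ _ , _)    (π _ ∶π _ ∶1)   e with () ← ≡.cong proj₁ (e 1F)
    compare (π _ ∶1∶ _ , _) (1∶ _ , _ ∶ _ , _) e = absurd (e zero) (e 1F)
    compare (π _ ∶π _ ∶1)   (1∶ _ , _ ∶ _ , _) e = absurd (e zero) (e 2F)
    compare (π _ ∶π _ ∶1)   (π _ ∶1∶ _ , _)    e = absurd (e 1F) (e 2F)

  -- Uses a⁻¹ = a² in 𝔽₄ˣ; the value is junk when a = 0.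
  inverse : E → E
  inverse (a , b) = square₄ a , square₄ a *₄ b *₄ τ (square₄ a)

  IsLocal : Set
  IsLocal = ∀ x → (x * inverse x ≡ (I , O) × inverse x * x ≡ (I , O)) ⊎ x * (O , I) ≡ (O , O)

  isLocal? : Dec IsLocal
  isLocal? = ∀E? λ x → ((_ ≟E _) ×-dec (_ ≟E _)) ⊎-dec (_ ≟E _)

  OnLine : Vector E 3 → Pred Point 0ℓ
  OnLine h P = dot h (coordinates P) ≡ (O , O)

  onLine? : ∀ h → Decidable (OnLine h)
  onLine? h P = _ ≟E _

  normalised : Fin 3 → E → E → Vector E 3
  normalised k y z = insertAt (y Vector.∷ z Vector.∷ Vector.[]) k (I , O)

  Arc : ∀ {k} → ℕ → Vec Point k → Set
  Arc n K = Unique K × (∀ k y z → count (onLine? (normalised k y z)) K ≤ℕ n)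

  arc? : ∀ {k} n (K : Vec Point k) → Dec (Arc n K)
  arc? n K = AllPairs.allPairs? (λ P Q → ¬? (P ≟ₚ Q)) K
       ×-dec (all? λ k → ∀E? λ y → ∀E? λ z → _ ℕ.≤? n)

  module _ (isLocal : IsLocal) (R : Ring 0ℓ 0ℓ)
    {φ : Ring.Carrier R → E}
    (φ-iso : IsRingIsomorphism (Ring.rawRing R) (Ring.rawRing chainRing) φ)
    where
    private
      open Ring R using (Carrier; _≈_; 0#; 1#)
      module R = Ring R
      module φ = IsRingIsomorphism φ-iso
      module R-dot = DotProduct R

      -- A set-theoretic section of `φ`. Identities about lifted elements are checked after applying
      -- `φ` and pulled back by injectivity, as in `reflect`.
      ψ : E → Carrier
      ψ e = proj₁ (φ.surjective e)

      φψ : ∀ e → φ (ψ e) ≡ e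
      φψ e = proj₂ (φ.surjective e) R.refl

      ψ1≈1 : ψ (I , O) ≈ 1#
      ψ1≈1 = φ.injective (≡.trans (φψ _) (≡.sym φ.1#-homo))

      φ-dot : ∀ {n} (h v : Vector Carrier n) → φ (R-dot.dot h v) ≡ dot (φ ∘ h) (φ ∘ v)
      φ-dot {zero}  h v = φ.0#-homo
      φ-dot {suc n} h v = ≡.trans (φ.+-homo _ _) (≡.cong₂ _+_ (φ.*-homo _ _) (φ-dot (h ∘ suc) (v ∘ suc)))

      π = ψ (O , I)

      π≉0 : ¬ π ≈ 0#
      π≉0 e with () ← ≡.trans (≡.sym (φψ (O , I))) (≡.trans (φ.⟦⟧-cong e) φ.0#-homo)

      reflect : ∀ {x y z e f} → φ x * φ y ≡ e → e ≡ f → φ z ≡ f → x R.* y ≈ z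
      reflect xy≡e e≡f z≡f =
        φ.injective (≡.trans (φ.*-homo _ _) (≡.trans xy≡e (≡.trans e≡f (≡.sym z≡f))))

      unit⊎annihilated : NonUnitsAnnihilatedBy R π
      unit⊎annihilated x with isLocal (φ x)
      ... | inj₁ (right , left) = inj₁ (ψ (inverse (φ x))
          , reflect (≡.cong (φ x *_) (φψ _)) right φ.1#-homo
          , reflect (≡.cong (_* φ x) (φψ _)) left φ.1#-homo)
      ... | inj₂ annihilated = inj₂ (reflect (≡.cong (φ x *_) (φψ _)) annihilated φ.0#-homo)

      open Lines R π π≉0 unit⊎annihilated using (line-covector)

      lift : Point → Vector Carrier 3
      lift P = ψ ∘ coordinates P

      point : Point → IncidenceStructure.Point (PHG2 R)
      point P = record
        { submodule = record
          { Member = λ v → ∃[ r ] (∀ i → v i ≈ lift P i R.* r)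
          ; resp-≈ = λ v≈w (r , e) → r , λ i → R.trans (R.sym (v≈w i)) (e i)
          ; 0-mem  = 0# , λ i → R.sym (R.zeroʳ _)
          ; +-mem  = λ (r , e) (s , e′) → r R.+ s , λ i →
              R.trans (R.+-cong (e i) (e′ i)) (R.sym (R.distribˡ _ r s))
          ; *ᵣ-mem = λ s (r , e) → r R.* s , λ i →
              R.trans (R.*-congʳ (e i)) (R.*-assoc _ r s) }
        ; isFreeOfRank = const (lift P) , record
          { basis-mem   = λ _ → 1# , λ i → R.sym (R.*-identityʳ _)
          ; spanning    = λ (r , e) → const r , λ i → R.trans (e i) (R.sym (R.+-identityʳ _))
          -- The coordinate equal to 1 exposes the scalar itself.
          ; independent = λ { r e zero → let i , Pᵢ≡1 = coordinates-1 P in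
              R.trans (R.sym (R.*-identityˡ _)) (R.trans
                (R.*-congʳ (R.sym (R.trans (R.reflexive (≡.cong ψ Pᵢ≡1)) ψ1≈1)))
                (R.trans (R.sym (R.+-identityʳ _)) (e i))) } } }

      lift-mem : ∀ P → FreeSubmodule.Member (point P) (lift P)
      lift-mem P = 1# , λ i → R.sym (R.*-identityʳ _)

      -- The generator of P is a multiple of the generator of Q; `φ` carries this proportionality to
      -- the table coordinates.
      point-injective : ∀ P Q → IncidenceStructure._≈ₚ_ (PHG2 R) (point P) (point Q) → P ≡ Q
      point-injective P Q (P⊆Q , _) with r , e ← P⊆Q (lift-mem P) =
        coordinates-proportional⇒≡ P Q (φ r) λ i → ≡.trans (≡.sym (φψ _))
          (≡.trans (φ.⟦⟧-cong (e i)) (≡.trans (φ.*-homo _ _) (≡.cong (_* φ r) (φψ _))))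

      -- The case split is there because `insertAt` and `removeAt` reduce at concrete indices;
      -- pointwise equality avoids function extensionality.
      normalise : (h : Vector E 3) (k : Fin 3) → h k ≡ (I , O) →
                  ∀ i → normalised k (removeAt h k zero) (removeAt h k 1F) i ≡ h i
      normalise h 0F h₀≡1 0F = ≡.sym h₀≡1
      normalise h 0F h₀≡1 1F = ≡.refl
      normalise h 0F h₀≡1 2F = ≡.refl
      normalise h 1F h₁≡1 0F = ≡.refl
      normalise h 1F h₁≡1 1F = ≡.sym h₁≡1
      normalise h 1F h₁≡1 2F = ≡.refl
      normalise h 2F h₂≡1 0F = ≡.refl
      normalise h 2F h₂≡1 1F = ≡.refl
      normalise h 2F h₂≡1 2F = ≡.sym h₂≡1

    isProjectiveArc : ∀ {k n} (K : Vec Point k) → Arc n K →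
      Σ[ 𝒦 ∈ (Fin k → IncidenceStructure.Point (PHG2 R)) ] IsProjectiveArc (PHG2 R) k n 𝒦
    isProjectiveArc {k} {n} K (unique , bounded) = point ∘ lookup K , record
      { distinct = λ {i} {j} e → lookup-injective unique i j (point-injective _ _ e)
      ; bounded  = bound }
      where
      bound : (l : IncidenceStructure.Line (PHG2 R)) (s : Subset k) →
              (∀ {i} → i ∈ₛ s → IncidenceStructure._I_ (PHG2 R) (point (lookup K i)) l) → ∣ s ∣ ≤ℕ n
      bound l s s⊆l = ℕ.≤-trans
        (∣s∣≤count (onLine? (normalised m y z)) K s λ {i} i∈s →
          on (lookup K i) (s⊆l i∈s (lift-mem (lookup K i))))
        (bounded m y z)
        where
        covector = line-covector l
        h = proj₁ covector
        m = proj₁ (proj₂ covector)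
        y = φ (h (punchIn m 0F))
        z = φ (h (punchIn m 1F))
        φhₘ≡1 : φ (h m) ≡ (I , O)
        φhₘ≡1 = ≡.trans (φ.⟦⟧-cong (proj₁ (proj₂ (proj₂ covector)))) φ.1#-homo
        -- The equation for the covector over `R` is transported by `φ`, and φ ∘ h is recognised as
        -- one of the covectors covered by the finite check.
        on : ∀ P → FreeSubmodule.Member l (lift P) → OnLine (normalised m y z) P
        on P P∈l = begin
          dot (normalised m y z) (coordinates P)
            ≡⟨ sum-cong-≋ (λ i → ≡.cong₂ _*_ (normalise (φ ∘ h) m φhₘ≡1 i) (≡.sym (φψ (coordinates P i)))) ⟩
          dot (φ ∘ h) (φ ∘ lift P)     ≡⟨ φ-dot h (lift P) ⟨
          φ (R-dot.dot h (lift P))     ≡⟨ φ.⟦⟧-cong (proj₂ (proj₂ (proj₂ covector)) P∈l) ⟩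
          φ 0#                         ≡⟨ φ.0#-homo ⟩
          (O , O)                      ∎
          where open ≡.≡-Reasoning

-- The arcs

𝔾₄-arc : Vec Point 201
𝔾₄-arc =
  (1∶ O , O ∶ O , O) ∷ (1∶ O , O ∶ I , O) ∷ (1∶ O , O ∶ ω , O) ∷ (1∶ O , O ∶ ω̄ , O) ∷
  (1∶ O , O ∶ I , I) ∷ (1∶ O , O ∶ ω̄ , I) ∷ (1∶ O , O ∶ O , ω) ∷ (1∶ O , O ∶ I , ω) ∷
  (1∶ O , O ∶ ω , ω) ∷ (1∶ O , O ∶ ω̄ , ω) ∷ (1∶ O , O ∶ ω̄ , ω̄) ∷ (1∶ I , O ∶ O , O) ∷
  (1∶ I , O ∶ I , O) ∷ (1∶ I , O ∶ ω̄ , O) ∷ (1∶ I , O ∶ O , I) ∷ (1∶ I , O ∶ I , I) ∷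
  (1∶ I , O ∶ ω̄ , I) ∷ (1∶ I , O ∶ I , ω) ∷ (1∶ I , O ∶ ω , ω) ∷ (1∶ I , O ∶ I , ω̄) ∷
  (1∶ I , O ∶ ω , ω̄) ∷ (1∶ I , O ∶ ω̄ , ω̄) ∷ (1∶ ω , O ∶ ω , O) ∷ (1∶ ω , O ∶ ω̄ , O) ∷
  (1∶ ω , O ∶ ω , I) ∷ (1∶ ω , O ∶ ω̄ , I) ∷ (1∶ ω , O ∶ I , ω) ∷ (1∶ ω , O ∶ ω , ω) ∷
  (1∶ ω , O ∶ ω̄ , ω) ∷ (1∶ ω , O ∶ ω , ω̄) ∷ (1∶ ω , O ∶ ω̄ , ω̄) ∷ (1∶ ω̄ , O ∶ O , O) ∷
  (1∶ ω̄ , O ∶ I , O) ∷ (1∶ ω̄ , O ∶ ω , O) ∷ (1∶ ω̄ , O ∶ ω̄ , O) ∷ (1∶ ω̄ , O ∶ ω , I) ∷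
  (1∶ ω̄ , O ∶ O , ω) ∷ (1∶ ω̄ , O ∶ ω , ω) ∷ (1∶ ω̄ , O ∶ O , ω̄) ∷ (1∶ ω̄ , O ∶ I , ω̄) ∷
  (1∶ ω̄ , O ∶ ω , ω̄) ∷ (1∶ ω̄ , O ∶ ω̄ , ω̄) ∷ (1∶ O , I ∶ O , O) ∷ (1∶ O , I ∶ ω , O) ∷
  (1∶ O , I ∶ ω̄ , O) ∷ (1∶ O , I ∶ I , I) ∷ (1∶ O , I ∶ ω̄ , I) ∷ (1∶ O , I ∶ O , ω) ∷
  (1∶ O , I ∶ I , ω) ∷ (1∶ O , I ∶ ω , ω) ∷ (1∶ O , I ∶ ω̄ , ω) ∷ (1∶ O , I ∶ I , ω̄) ∷
  (1∶ O , I ∶ ω̄ , ω̄) ∷ (1∶ I , I ∶ ω , O) ∷ (1∶ I , I ∶ ω̄ , O) ∷ (1∶ I , I ∶ ω , I) ∷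
  (1∶ I , I ∶ ω̄ , I) ∷ (1∶ I , I ∶ O , ω) ∷ (1∶ I , I ∶ ω̄ , ω) ∷ (1∶ I , I ∶ O , ω̄) ∷
  (1∶ ω , I ∶ O , O) ∷ (1∶ ω , I ∶ I , O) ∷ (1∶ ω , I ∶ O , I) ∷ (1∶ ω , I ∶ I , I) ∷
  (1∶ ω , I ∶ ω̄ , I) ∷ (1∶ ω , I ∶ O , ω) ∷ (1∶ ω , I ∶ I , ω) ∷ (1∶ ω , I ∶ O , ω̄) ∷
  (1∶ ω , I ∶ I , ω̄) ∷ (1∶ ω̄ , I ∶ O , O) ∷ (1∶ ω̄ , I ∶ ω , O) ∷ (1∶ ω̄ , I ∶ I , I) ∷
  (1∶ ω̄ , I ∶ ω , I) ∷ (1∶ ω̄ , I ∶ ω̄ , I) ∷ (1∶ ω̄ , I ∶ O , ω) ∷ (1∶ ω̄ , I ∶ I , ω) ∷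
  (1∶ ω̄ , I ∶ ω , ω) ∷ (1∶ ω̄ , I ∶ ω̄ , ω) ∷ (1∶ ω̄ , I ∶ O , ω̄) ∷ (1∶ ω̄ , I ∶ ω , ω̄) ∷
  (1∶ O , ω ∶ I , O) ∷ (1∶ O , ω ∶ O , I) ∷ (1∶ O , ω ∶ I , I) ∷ (1∶ O , ω ∶ ω , I) ∷
  (1∶ O , ω ∶ O , ω̄) ∷ (1∶ O , ω ∶ I , ω̄) ∷ (1∶ O , ω ∶ ω , ω̄) ∷ (1∶ I , ω ∶ I , O) ∷
  (1∶ I , ω ∶ ω , O) ∷ (1∶ I , ω ∶ I , I) ∷ (1∶ I , ω ∶ ω , I) ∷ (1∶ I , ω ∶ ω̄ , I) ∷
  (1∶ I , ω ∶ O , ω) ∷ (1∶ I , ω ∶ I , ω) ∷ (1∶ I , ω ∶ ω̄ , ω) ∷ (1∶ I , ω ∶ O , ω̄) ∷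
  (1∶ I , ω ∶ I , ω̄) ∷ (1∶ I , ω ∶ ω̄ , ω̄) ∷ (1∶ ω , ω ∶ ω , O) ∷ (1∶ ω , ω ∶ ω̄ , O) ∷
  (1∶ ω , ω ∶ I , I) ∷ (1∶ ω , ω ∶ ω , I) ∷ (1∶ ω , ω ∶ ω , ω) ∷ (1∶ ω , ω ∶ ω , ω̄) ∷
  (1∶ ω̄ , ω ∶ O , O) ∷ (1∶ ω̄ , ω ∶ I , O) ∷ (1∶ ω̄ , ω ∶ ω , O) ∷ (1∶ ω̄ , ω ∶ ω̄ , O) ∷
  (1∶ ω̄ , ω ∶ ω , I) ∷ (1∶ ω̄ , ω ∶ O , ω) ∷ (1∶ ω̄ , ω ∶ ω , ω) ∷ (1∶ ω̄ , ω ∶ O , ω̄) ∷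
  (1∶ ω̄ , ω ∶ I , ω̄) ∷ (1∶ ω̄ , ω ∶ ω , ω̄) ∷ (1∶ ω̄ , ω ∶ ω̄ , ω̄) ∷ (1∶ O , ω̄ ∶ I , O) ∷
  (1∶ O , ω̄ ∶ ω̄ , O) ∷ (1∶ O , ω̄ ∶ O , I) ∷ (1∶ O , ω̄ ∶ ω , I) ∷ (1∶ O , ω̄ ∶ ω̄ , I) ∷
  (1∶ O , ω̄ ∶ I , ω) ∷ (1∶ O , ω̄ ∶ ω̄ , ω) ∷ (1∶ O , ω̄ ∶ O , ω̄) ∷ (1∶ O , ω̄ ∶ I , ω̄) ∷
  (1∶ O , ω̄ ∶ ω , ω̄) ∷ (1∶ O , ω̄ ∶ ω̄ , ω̄) ∷ (1∶ I , ω̄ ∶ O , O) ∷ (1∶ I , ω̄ ∶ I , O) ∷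
  (1∶ I , ω̄ ∶ ω̄ , O) ∷ (1∶ I , ω̄ ∶ O , I) ∷ (1∶ I , ω̄ ∶ I , I) ∷ (1∶ I , ω̄ ∶ I , ω) ∷
  (1∶ I , ω̄ ∶ ω , ω) ∷ (1∶ I , ω̄ ∶ ω̄ , ω) ∷ (1∶ I , ω̄ ∶ I , ω̄) ∷ (1∶ I , ω̄ ∶ ω , ω̄) ∷
  (1∶ I , ω̄ ∶ ω̄ , ω̄) ∷ (1∶ ω , ω̄ ∶ O , O) ∷ (1∶ ω , ω̄ ∶ O , I) ∷ (1∶ ω , ω̄ ∶ O , ω) ∷
  (1∶ ω , ω̄ ∶ ω̄ , ω) ∷ (1∶ ω , ω̄ ∶ O , ω̄) ∷ (1∶ ω , ω̄ ∶ I , ω̄) ∷ (1∶ ω̄ , ω̄ ∶ O , O) ∷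
  (1∶ ω̄ , ω̄ ∶ I , I) ∷ (1∶ ω̄ , ω̄ ∶ ω̄ , I) ∷ (1∶ ω̄ , ω̄ ∶ O , ω) ∷ (1∶ ω̄ , ω̄ ∶ I , ω) ∷
  (1∶ ω̄ , ω̄ ∶ ω̄ , ω) ∷ (1∶ ω̄ , ω̄ ∶ O , ω̄) ∷
  (π O ∶1∶ O , O) ∷ (π O ∶1∶ I , O) ∷ (π O ∶1∶ ω̄ , O) ∷ (π O ∶1∶ I , I) ∷ (π O ∶1∶ ω , I) ∷
  (π O ∶1∶ ω̄ , I) ∷ (π O ∶1∶ O , ω) ∷ (π O ∶1∶ O , ω̄) ∷ (π O ∶1∶ I , ω̄) ∷ (π O ∶1∶ ω̄ , ω̄) ∷
  (π I ∶1∶ O , O) ∷ (π I ∶1∶ I , O) ∷ (π I ∶1∶ ω̄ , O) ∷ (π I ∶1∶ O , I) ∷ (π I ∶1∶ I , I) ∷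
  (π I ∶1∶ ω , I) ∷ (π I ∶1∶ O , ω) ∷ (π I ∶1∶ ω̄ , ω) ∷ (π I ∶1∶ I , ω̄) ∷ (π I ∶1∶ ω , ω̄) ∷
  (π I ∶1∶ ω̄ , ω̄) ∷ (π ω ∶1∶ O , O) ∷ (π ω ∶1∶ I , O) ∷ (π ω ∶1∶ ω̄ , O) ∷ (π ω ∶1∶ O , I) ∷
  (π ω ∶1∶ I , I) ∷ (π ω ∶1∶ ω , I) ∷ (π ω ∶1∶ ω̄ , I) ∷ (π ω ∶1∶ ω , ω) ∷ (π ω ∶1∶ ω̄ , ω) ∷
  (π ω ∶1∶ O , ω̄) ∷ (π ω ∶1∶ I , ω̄) ∷ (π ω̄ ∶1∶ I , O) ∷ (π ω̄ ∶1∶ ω , O) ∷ (π ω̄ ∶1∶ O , I) ∷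
  (π ω̄ ∶1∶ I , I) ∷ (π ω̄ ∶1∶ ω , I) ∷ (π ω̄ ∶1∶ ω̄ , I) ∷ (π ω̄ ∶1∶ O , ω) ∷ (π ω̄ ∶1∶ ω̄ , ω) ∷
  (π ω̄ ∶1∶ O , ω̄) ∷ (π ω̄ ∶1∶ I , ω̄) ∷ (π ω̄ ∶1∶ ω̄ , ω̄) ∷
  (π O ∶π O ∶1) ∷ (π O ∶π I ∶1) ∷ (π I ∶π ω ∶1) ∷ (π I ∶π ω̄ ∶1) ∷ (π ω ∶π ω ∶1) ∷ (π ω ∶π ω̄ ∶1) ∷
  (π ω̄ ∶π O ∶1) ∷ (π ω̄ ∶π I ∶1) ∷ []

module 𝔾₄-Plane = ChainRingPlane id wittCarry G-laws

-- The plane has 336 lines, 20 through each point, so 201 points meet a line in just under 12 points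
-- on average. The bound 13 leaves little room and is confirmed by evaluating every count.
𝔾₄-isArc : 𝔾₄-Plane.Arc 13 𝔾₄-arc
𝔾₄-isArc = toWitness {a? = 𝔾₄-Plane.arc? 13 𝔾₄-arc} _

𝕊₄-arc : Vec Point 201
𝕊₄-arc =
  (1∶ O , O ∶ O , O) ∷ (1∶ O , O ∶ O , I) ∷ (1∶ O , O ∶ I , I) ∷ (1∶ O , O ∶ O , ω) ∷
  (1∶ O , O ∶ ω̄ , ω) ∷ (1∶ O , O ∶ I , ω̄) ∷ (1∶ O , O ∶ ω̄ , ω̄) ∷ (1∶ I , O ∶ O , O) ∷
  (1∶ I , O ∶ I , O) ∷ (1∶ I , O ∶ ω , O) ∷ (1∶ I , O ∶ ω̄ , O) ∷ (1∶ I , O ∶ ω , I) ∷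
  (1∶ I , O ∶ ω̄ , I) ∷ (1∶ I , O ∶ I , ω) ∷ (1∶ I , O ∶ ω , ω) ∷ (1∶ I , O ∶ ω̄ , ω) ∷
  (1∶ I , O ∶ O , ω̄) ∷ (1∶ I , O ∶ ω , ω̄) ∷ (1∶ ω , O ∶ O , O) ∷ (1∶ ω , O ∶ I , O) ∷
  (1∶ ω , O ∶ ω , O) ∷ (1∶ ω , O ∶ ω̄ , O) ∷ (1∶ ω , O ∶ I , I) ∷ (1∶ ω , O ∶ ω , I) ∷
  (1∶ ω , O ∶ ω̄ , I) ∷ (1∶ ω , O ∶ I , ω) ∷ (1∶ ω , O ∶ ω , ω) ∷ (1∶ ω , O ∶ O , ω̄) ∷
  (1∶ ω , O ∶ ω , ω̄) ∷ (1∶ ω̄ , O ∶ O , O) ∷ (1∶ ω̄ , O ∶ I , O) ∷ (1∶ ω̄ , O ∶ ω , O) ∷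
  (1∶ ω̄ , O ∶ ω̄ , O) ∷ (1∶ ω̄ , O ∶ I , I) ∷ (1∶ ω̄ , O ∶ ω̄ , I) ∷ (1∶ ω̄ , O ∶ O , ω) ∷
  (1∶ ω̄ , O ∶ I , ω) ∷ (1∶ ω̄ , O ∶ O , ω̄) ∷ (1∶ ω̄ , O ∶ ω , ω̄) ∷ (1∶ ω̄ , O ∶ ω̄ , ω̄) ∷
  (1∶ O , I ∶ O , O) ∷ (1∶ O , I ∶ I , O) ∷ (1∶ O , I ∶ ω , O) ∷ (1∶ O , I ∶ ω̄ , O) ∷
  (1∶ O , I ∶ O , I) ∷ (1∶ O , I ∶ ω , I) ∷ (1∶ O , I ∶ ω̄ , I) ∷ (1∶ O , I ∶ O , ω) ∷
  (1∶ O , I ∶ I , ω) ∷ (1∶ O , I ∶ ω , ω) ∷ (1∶ O , I ∶ ω , ω̄) ∷ (1∶ I , I ∶ I , O) ∷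
  (1∶ I , I ∶ ω̄ , O) ∷ (1∶ I , I ∶ O , I) ∷ (1∶ I , I ∶ ω̄ , I) ∷ (1∶ I , I ∶ O , ω) ∷
  (1∶ I , I ∶ I , ω) ∷ (1∶ I , I ∶ ω̄ , ω) ∷ (1∶ ω , I ∶ I , O) ∷ (1∶ ω , I ∶ ω , O) ∷
  (1∶ ω , I ∶ ω̄ , O) ∷ (1∶ ω , I ∶ O , I) ∷ (1∶ ω , I ∶ I , I) ∷ (1∶ ω , I ∶ ω , I) ∷
  (1∶ ω , I ∶ ω̄ , I) ∷ (1∶ ω , I ∶ O , ω) ∷ (1∶ ω , I ∶ I , ω) ∷ (1∶ ω , I ∶ ω , ω) ∷
  (1∶ ω , I ∶ ω , ω̄) ∷ (1∶ ω̄ , I ∶ O , O) ∷ (1∶ ω̄ , I ∶ ω̄ , O) ∷ (1∶ ω̄ , I ∶ O , I) ∷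
  (1∶ ω̄ , I ∶ I , I) ∷ (1∶ ω̄ , I ∶ I , ω) ∷ (1∶ ω̄ , I ∶ ω , ω) ∷ (1∶ ω̄ , I ∶ ω̄ , ω) ∷
  (1∶ ω̄ , I ∶ O , ω̄) ∷ (1∶ ω̄ , I ∶ I , ω̄) ∷ (1∶ ω̄ , I ∶ ω̄ , ω̄) ∷ (1∶ O , ω ∶ O , O) ∷
  (1∶ O , ω ∶ ω , O) ∷ (1∶ O , ω ∶ ω̄ , O) ∷ (1∶ O , ω ∶ O , I) ∷ (1∶ O , ω ∶ I , I) ∷
  (1∶ O , ω ∶ ω , I) ∷ (1∶ O , ω ∶ ω̄ , I) ∷ (1∶ O , ω ∶ O , ω) ∷ (1∶ O , ω ∶ ω , ω) ∷
  (1∶ O , ω ∶ I , ω̄) ∷ (1∶ O , ω ∶ ω , ω̄) ∷ (1∶ I , ω ∶ ω , O) ∷ (1∶ I , ω ∶ ω̄ , O) ∷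
  (1∶ I , ω ∶ O , I) ∷ (1∶ I , ω ∶ I , I) ∷ (1∶ I , ω ∶ ω , I) ∷ (1∶ I , ω ∶ ω̄ , I) ∷
  (1∶ I , ω ∶ O , ω) ∷ (1∶ I , ω ∶ ω , ω) ∷ (1∶ I , ω ∶ ω̄ , ω) ∷ (1∶ I , ω ∶ I , ω̄) ∷
  (1∶ I , ω ∶ ω , ω̄) ∷ (1∶ ω , ω ∶ O , O) ∷ (1∶ ω , ω ∶ I , O) ∷ (1∶ ω , ω ∶ I , I) ∷
  (1∶ ω , ω ∶ I , ω) ∷ (1∶ ω , ω ∶ ω̄ , ω) ∷ (1∶ ω , ω ∶ O , ω̄) ∷ (1∶ ω , ω ∶ ω̄ , ω̄) ∷
  (1∶ ω̄ , ω ∶ I , O) ∷ (1∶ ω̄ , ω ∶ ω̄ , O) ∷ (1∶ ω̄ , ω ∶ O , I) ∷ (1∶ ω̄ , ω ∶ I , I) ∷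
  (1∶ ω̄ , ω ∶ ω , I) ∷ (1∶ ω̄ , ω ∶ ω̄ , I) ∷ (1∶ ω̄ , ω ∶ O , ω) ∷ (1∶ ω̄ , ω ∶ ω̄ , ω) ∷
  (1∶ ω̄ , ω ∶ O , ω̄) ∷ (1∶ ω̄ , ω ∶ I , ω̄) ∷ (1∶ ω̄ , ω ∶ ω , ω̄) ∷ (1∶ O , ω̄ ∶ O , O) ∷
  (1∶ O , ω̄ ∶ I , O) ∷ (1∶ O , ω̄ ∶ ω , O) ∷ (1∶ O , ω̄ ∶ O , I) ∷ (1∶ O , ω̄ ∶ ω , I) ∷
  (1∶ O , ω̄ ∶ O , ω) ∷ (1∶ O , ω̄ ∶ I , ω) ∷ (1∶ O , ω̄ ∶ ω , ω) ∷ (1∶ O , ω̄ ∶ ω̄ , ω) ∷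
  (1∶ O , ω̄ ∶ ω , ω̄) ∷ (1∶ O , ω̄ ∶ ω̄ , ω̄) ∷ (1∶ I , ω̄ ∶ O , O) ∷ (1∶ I , ω̄ ∶ ω , O) ∷
  (1∶ I , ω̄ ∶ ω̄ , O) ∷ (1∶ I , ω̄ ∶ I , I) ∷ (1∶ I , ω̄ ∶ ω , I) ∷ (1∶ I , ω̄ ∶ ω̄ , I) ∷
  (1∶ I , ω̄ ∶ ω , ω) ∷ (1∶ I , ω̄ ∶ ω̄ , ω) ∷ (1∶ I , ω̄ ∶ O , ω̄) ∷ (1∶ I , ω̄ ∶ I , ω̄) ∷
  (1∶ I , ω̄ ∶ ω , ω̄) ∷ (1∶ ω , ω̄ ∶ I , O) ∷ (1∶ ω , ω̄ ∶ ω , O) ∷ (1∶ ω , ω̄ ∶ O , I) ∷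
  (1∶ ω , ω̄ ∶ I , I) ∷ (1∶ ω , ω̄ ∶ ω , I) ∷ (1∶ ω , ω̄ ∶ O , ω) ∷ (1∶ ω , ω̄ ∶ I , ω) ∷
  (1∶ ω , ω̄ ∶ ω , ω) ∷ (1∶ ω , ω̄ ∶ ω̄ , ω) ∷ (1∶ ω , ω̄ ∶ ω , ω̄) ∷ (1∶ ω , ω̄ ∶ ω̄ , ω̄) ∷
  (1∶ ω̄ , ω̄ ∶ O , O) ∷ (1∶ ω̄ , ω̄ ∶ I , O) ∷ (1∶ ω̄ , ω̄ ∶ ω , O) ∷ (1∶ ω̄ , ω̄ ∶ O , I) ∷
  (1∶ ω̄ , ω̄ ∶ ω , I) ∷ (1∶ ω̄ , ω̄ ∶ ω̄ , I) ∷ (1∶ ω̄ , ω̄ ∶ O , ω) ∷ (1∶ ω̄ , ω̄ ∶ I , ω) ∷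
  (1∶ ω̄ , ω̄ ∶ ω̄ , ω) ∷ (1∶ ω̄ , ω̄ ∶ I , ω̄) ∷ (1∶ ω̄ , ω̄ ∶ ω̄ , ω̄) ∷
  (π O ∶1∶ I , I) ∷ (π O ∶1∶ ω , ω) ∷ (π I ∶1∶ I , O) ∷ (π I ∶1∶ ω , O) ∷ (π I ∶1∶ I , I) ∷
  (π I ∶1∶ ω , I) ∷ (π I ∶1∶ I , ω) ∷ (π I ∶1∶ ω , ω) ∷ (π I ∶1∶ I , ω̄) ∷ (π I ∶1∶ ω , ω̄) ∷
  (π ω ∶1∶ O , O) ∷ (π ω ∶1∶ ω̄ , O) ∷ (π ω ∶1∶ O , I) ∷ (π ω ∶1∶ ω̄ , I) ∷ (π ω ∶1∶ O , ω) ∷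
  (π ω ∶1∶ ω̄ , ω) ∷ (π ω ∶1∶ O , ω̄) ∷ (π ω ∶1∶ I , ω̄) ∷ (π ω ∶1∶ ω , ω̄) ∷ (π ω ∶1∶ ω̄ , ω̄) ∷
  (π ω̄ ∶1∶ O , O) ∷ (π ω̄ ∶1∶ ω , O) ∷ (π ω̄ ∶1∶ ω̄ , O) ∷ (π ω̄ ∶1∶ O , I) ∷ (π ω̄ ∶1∶ ω̄ , I) ∷
  (π ω̄ ∶1∶ O , ω) ∷ (π ω̄ ∶1∶ I , ω) ∷ (π ω̄ ∶1∶ ω̄ , ω) ∷ (π ω̄ ∶1∶ O , ω̄) ∷ (π ω̄ ∶1∶ ω̄ , ω̄) ∷
  (π I ∶π O ∶1) ∷ (π I ∶π I ∶1) ∷ (π I ∶π ω ∶1) ∷ (π I ∶π ω̄ ∶1) ∷ (π ω̄ ∶π O ∶1) ∷ (π ω̄ ∶π I ∶1) ∷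
  (π ω̄ ∶π ω ∶1) ∷ (π ω̄ ∶π ω̄ ∶1) ∷ []

module 𝕊₄-Plane = ChainRingPlane id noCarry S-laws

𝕊₄-isArc : 𝕊₄-Plane.Arc 13 𝕊₄-arc
𝕊₄-isArc = toWitness {a? = 𝕊₄-Plane.arc? 13 𝕊₄-arc} _

𝕋₄-arc : Vec Point 201
𝕋₄-arc =
  (1∶ O , O ∶ ω̄ , O) ∷ (1∶ O , O ∶ O , I) ∷ (1∶ O , O ∶ I , I) ∷ (1∶ O , O ∶ ω , I) ∷
  (1∶ O , O ∶ O , ω) ∷ (1∶ O , O ∶ ω̄ , ω) ∷ (1∶ O , O ∶ O , ω̄) ∷ (1∶ O , O ∶ I , ω̄) ∷
  (1∶ O , O ∶ ω , ω̄) ∷ (1∶ O , O ∶ ω̄ , ω̄) ∷ (1∶ I , O ∶ O , O) ∷ (1∶ I , O ∶ I , O) ∷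
  (1∶ I , O ∶ ω̄ , O) ∷ (1∶ I , O ∶ I , I) ∷ (1∶ I , O ∶ ω , I) ∷ (1∶ I , O ∶ ω̄ , I) ∷
  (1∶ I , O ∶ O , ω) ∷ (1∶ I , O ∶ I , ω) ∷ (1∶ I , O ∶ O , ω̄) ∷ (1∶ I , O ∶ ω̄ , ω̄) ∷
  (1∶ ω , O ∶ O , O) ∷ (1∶ ω , O ∶ I , O) ∷ (1∶ ω , O ∶ ω , O) ∷ (1∶ ω , O ∶ O , I) ∷
  (1∶ ω , O ∶ ω̄ , I) ∷ (1∶ ω , O ∶ O , ω) ∷ (1∶ ω , O ∶ I , ω) ∷ (1∶ ω , O ∶ O , ω̄) ∷
  (1∶ ω , O ∶ ω , ω̄) ∷ (1∶ ω̄ , O ∶ O , O) ∷ (1∶ ω̄ , O ∶ I , O) ∷ (1∶ ω̄ , O ∶ ω , O) ∷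
  (1∶ ω̄ , O ∶ O , I) ∷ (1∶ ω̄ , O ∶ ω , I) ∷ (1∶ ω̄ , O ∶ O , ω) ∷ (1∶ ω̄ , O ∶ I , ω) ∷
  (1∶ ω̄ , O ∶ ω̄ , ω) ∷ (1∶ ω̄ , O ∶ I , ω̄) ∷ (1∶ ω̄ , O ∶ ω , ω̄) ∷ (1∶ ω̄ , O ∶ ω̄ , ω̄) ∷
  (1∶ O , I ∶ I , O) ∷ (1∶ O , I ∶ ω̄ , O) ∷ (1∶ O , I ∶ O , I) ∷ (1∶ O , I ∶ I , I) ∷
  (1∶ O , I ∶ ω , I) ∷ (1∶ O , I ∶ ω̄ , I) ∷ (1∶ O , I ∶ O , ω) ∷ (1∶ O , I ∶ O , ω̄) ∷
  (1∶ O , I ∶ I , ω̄) ∷ (1∶ O , I ∶ ω , ω̄) ∷ (1∶ I , I ∶ O , O) ∷ (1∶ I , I ∶ I , O) ∷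
  (1∶ I , I ∶ ω , O) ∷ (1∶ I , I ∶ O , I) ∷ (1∶ I , I ∶ I , I) ∷ (1∶ I , I ∶ ω , I) ∷
  (1∶ I , I ∶ ω̄ , I) ∷ (1∶ I , I ∶ ω̄ , ω) ∷ (1∶ I , I ∶ I , ω̄) ∷ (1∶ ω , I ∶ I , O) ∷
  (1∶ ω , I ∶ ω , O) ∷ (1∶ ω , I ∶ ω̄ , O) ∷ (1∶ ω , I ∶ I , I) ∷ (1∶ ω , I ∶ ω , I) ∷
  (1∶ ω , I ∶ I , ω) ∷ (1∶ ω , I ∶ ω̄ , ω) ∷ (1∶ ω , I ∶ I , ω̄) ∷ (1∶ ω , I ∶ ω̄ , ω̄) ∷
  (1∶ ω̄ , I ∶ O , O) ∷ (1∶ ω̄ , I ∶ I , O) ∷ (1∶ ω̄ , I ∶ ω , I) ∷ (1∶ ω̄ , I ∶ ω̄ , I) ∷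
  (1∶ ω̄ , I ∶ O , ω) ∷ (1∶ ω̄ , I ∶ ω̄ , ω) ∷ (1∶ ω̄ , I ∶ O , ω̄) ∷ (1∶ ω̄ , I ∶ I , ω̄) ∷
  (1∶ ω̄ , I ∶ ω , ω̄) ∷ (1∶ ω̄ , I ∶ ω̄ , ω̄) ∷ (1∶ O , ω ∶ I , O) ∷ (1∶ O , ω ∶ ω , O) ∷
  (1∶ O , ω ∶ O , I) ∷ (1∶ O , ω ∶ ω , I) ∷ (1∶ O , ω ∶ I , ω) ∷ (1∶ O , ω ∶ ω̄ , ω) ∷
  (1∶ O , ω ∶ O , ω̄) ∷ (1∶ O , ω ∶ ω , ω̄) ∷ (1∶ O , ω ∶ ω̄ , ω̄) ∷ (1∶ I , ω ∶ ω , O) ∷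
  (1∶ I , ω ∶ ω̄ , O) ∷ (1∶ I , ω ∶ O , I) ∷ (1∶ I , ω ∶ O , ω) ∷ (1∶ I , ω ∶ I , ω) ∷
  (1∶ I , ω ∶ ω , ω) ∷ (1∶ I , ω ∶ O , ω̄) ∷ (1∶ I , ω ∶ I , ω̄) ∷ (1∶ I , ω ∶ ω , ω̄) ∷
  (1∶ I , ω ∶ ω̄ , ω̄) ∷ (1∶ ω , ω ∶ O , O) ∷ (1∶ ω , ω ∶ ω̄ , O) ∷ (1∶ ω , ω ∶ O , I) ∷
  (1∶ ω , ω ∶ ω , I) ∷ (1∶ ω , ω ∶ ω̄ , I) ∷ (1∶ ω , ω ∶ O , ω) ∷ (1∶ ω , ω ∶ ω̄ , ω) ∷
  (1∶ ω , ω ∶ O , ω̄) ∷ (1∶ ω , ω ∶ ω , ω̄) ∷ (1∶ ω̄ , ω ∶ I , O) ∷ (1∶ ω̄ , ω ∶ ω , O) ∷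
  (1∶ ω̄ , ω ∶ ω̄ , O) ∷ (1∶ ω̄ , ω ∶ ω , I) ∷ (1∶ ω̄ , ω ∶ ω̄ , I) ∷ (1∶ ω̄ , ω ∶ O , ω) ∷
  (1∶ ω̄ , ω ∶ I , ω) ∷ (1∶ ω̄ , ω ∶ ω̄ , ω) ∷ (1∶ ω̄ , ω ∶ O , ω̄) ∷ (1∶ ω̄ , ω ∶ I , ω̄) ∷
  (1∶ ω̄ , ω ∶ ω , ω̄) ∷ (1∶ O , ω̄ ∶ I , O) ∷ (1∶ O , ω̄ ∶ ω , O) ∷ (1∶ O , ω̄ ∶ ω̄ , O) ∷
  (1∶ O , ω̄ ∶ ω , I) ∷ (1∶ O , ω̄ ∶ ω̄ , I) ∷ (1∶ O , ω̄ ∶ O , ω) ∷ (1∶ O , ω̄ ∶ I , ω) ∷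
  (1∶ O , ω̄ ∶ ω̄ , ω) ∷ (1∶ O , ω̄ ∶ I , ω̄) ∷ (1∶ O , ω̄ ∶ ω , ω̄) ∷ (1∶ I , ω̄ ∶ O , O) ∷
  (1∶ I , ω̄ ∶ ω , O) ∷ (1∶ I , ω̄ ∶ ω̄ , O) ∷ (1∶ I , ω̄ ∶ O , I) ∷ (1∶ I , ω̄ ∶ ω , I) ∷
  (1∶ I , ω̄ ∶ ω̄ , I) ∷ (1∶ I , ω̄ ∶ I , ω) ∷ (1∶ I , ω̄ ∶ ω̄ , ω) ∷ (1∶ I , ω̄ ∶ I , ω̄) ∷
  (1∶ I , ω̄ ∶ ω , ω̄) ∷ (1∶ ω , ω̄ ∶ O , O) ∷ (1∶ ω , ω̄ ∶ I , O) ∷ (1∶ ω , ω̄ ∶ I , I) ∷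
  (1∶ ω , ω̄ ∶ ω̄ , I) ∷ (1∶ ω , ω̄ ∶ I , ω) ∷ (1∶ ω , ω̄ ∶ ω̄ , ω) ∷ (1∶ ω , ω̄ ∶ O , ω̄) ∷
  (1∶ ω , ω̄ ∶ I , ω̄) ∷ (1∶ ω̄ , ω̄ ∶ O , O) ∷ (1∶ ω̄ , ω̄ ∶ ω̄ , O) ∷ (1∶ ω̄ , ω̄ ∶ O , I) ∷
  (1∶ ω̄ , ω̄ ∶ ω , I) ∷ (1∶ ω̄ , ω̄ ∶ ω̄ , I) ∷ (1∶ ω̄ , ω̄ ∶ I , ω) ∷ (1∶ ω̄ , ω̄ ∶ ω , ω̄) ∷
  (π O ∶1∶ I , O) ∷ (π O ∶1∶ ω , O) ∷ (π O ∶1∶ O , I) ∷ (π O ∶1∶ ω̄ , I) ∷ (π O ∶1∶ O , ω) ∷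
  (π O ∶1∶ I , ω) ∷ (π O ∶1∶ ω̄ , ω) ∷ (π O ∶1∶ O , ω̄) ∷ (π O ∶1∶ ω , ω̄) ∷ (π O ∶1∶ ω̄ , ω̄) ∷
  (π I ∶1∶ O , O) ∷ (π I ∶1∶ I , O) ∷ (π I ∶1∶ ω , O) ∷ (π I ∶1∶ ω̄ , O) ∷ (π I ∶1∶ O , I) ∷
  (π I ∶1∶ I , I) ∷ (π I ∶1∶ ω , I) ∷ (π I ∶1∶ ω̄ , I) ∷ (π I ∶1∶ I , ω) ∷ (π I ∶1∶ ω , ω) ∷
  (π I ∶1∶ ω̄ , ω) ∷ (π ω ∶1∶ O , O) ∷ (π ω ∶1∶ I , O) ∷ (π ω ∶1∶ O , I) ∷ (π ω ∶1∶ ω , I) ∷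
  (π ω ∶1∶ I , ω) ∷ (π ω ∶1∶ ω̄ , ω) ∷ (π ω ∶1∶ ω̄ , ω̄) ∷ (π ω̄ ∶1∶ O , O) ∷ (π ω̄ ∶1∶ I , O) ∷
  (π ω̄ ∶1∶ ω̄ , O) ∷ (π ω̄ ∶1∶ I , I) ∷ (π ω̄ ∶1∶ ω , I) ∷ (π ω̄ ∶1∶ ω̄ , I) ∷ (π ω̄ ∶1∶ O , ω) ∷
  (π ω̄ ∶1∶ I , ω) ∷ (π ω̄ ∶1∶ ω , ω) ∷ (π ω̄ ∶1∶ O , ω̄) ∷ (π ω̄ ∶1∶ ω , ω̄) ∷
  (π O ∶π O ∶1) ∷ (π O ∶π ω ∶1) ∷ (π I ∶π O ∶1) ∷ (π I ∶π ω ∶1) ∷ (π ω ∶π I ∶1) ∷ (π ω ∶π ω ∶1) ∷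
  (π ω ∶π ω̄ ∶1) ∷ (π ω̄ ∶π O ∶1) ∷ (π ω̄ ∶π I ∶1) ∷ (π ω̄ ∶π ω̄ ∶1) ∷ []

module 𝕋₄-Plane = ChainRingPlane square₄ noCarry T-laws

𝕋₄-isArc : 𝕋₄-Plane.Arc 13 𝕋₄-arc
𝕋₄-isArc = toWitness {a? = 𝕋₄-Plane.arc? 13 𝕋₄-arc} _

theorem3p8 : (R : Ring 0ℓ 0ℓ) → R ≡ 𝔾₄ ⊎ R ≡ 𝕊₄ ⊎ R ≡ 𝕋₄ →
    Σ[ K ∈ (Fin 201 → IncidenceStructure.Point (PHG2 R)) ] IsProjectiveArc (PHG2 R) 201 13 K
theorem3p8 R (inj₁ ≡.refl) =
  𝔾₄-Plane.isProjectiveArc (toWitness {a? = 𝔾₄-Plane.isLocal?} _) R 𝔾₄≅ 𝔾₄-arc 𝔾₄-isArc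
theorem3p8 R (inj₂ (inj₁ ≡.refl)) =
  𝕊₄-Plane.isProjectiveArc (toWitness {a? = 𝕊₄-Plane.isLocal?} _) R 𝕊₄≅ 𝕊₄-arc 𝕊₄-isArc
theorem3p8 R (inj₂ (inj₂ ≡.refl)) =
  𝕋₄-Plane.isProjectiveArc (toWitness {a? = 𝕋₄-Plane.isLocal?} _) R 𝕋₄≅ 𝕋₄-arc 𝕋₄-isArc
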